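{- For all integers $d_1,d_2\ge 0$, the Cartesian product $T(d_1)\times T(d_2)$ of a $d_1$-simplex $T(d_1)$ and a $d_2$-simplex $T(d_2)$ is $\lfloor (d_1+d_2)/2\rfloor$-linked.
   Context: A (convex) polytope is the convex hull of a finite set of points in some $\mathbb{R}^d$. A $d$-simplex $T(d)$ is the convex hull of $d+1$ affinely independent points in $\mathbb{R}^d$. The Cartesian product of a $d$-polytope $P\subset\mathbb{R}^{d}$ and a $d'$-polytope $P'\subset\mathbb{R}^{d'}$ is the polytope $P\times P'=\{(p,p')\in\mathbb{R}^{d+d'} : p\in P,\ p'\in P'\}$. The graph of a polytope is the undirected graph formed by its vertices and edges (its $0$- and $1$-dimensional faces). A polytope is called $k$-linked if its graph is $k$-linked. For an integer $k\ge 0$, a graph $G$ is $k$-linked if it has at least $2k$ vertices and, for every set $X$ of exactly $2k$ distinct vertices of $G$ and every partition of $X$ into pairs $\{s_1,t_1\},\ldots,\{s_k,t_k\}$, there exist $k$ pairwise vertex-disjoint paths $L_1,\ldots,L_k$ in $G$ such that $L_i$ joins $s_i$ to $t_i$ for each $i\in\{1,\ldots,k\}$ (for $k=0$ the condition is vacuous). -}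

module Defs where

open import Algebra.Apartness.Bundles using (HeytingField)
open import Algebra.Bundles using (CommutativeRing)
import Algebra.Properties.Semiring.Sum as SemiringSum
open import Data.Fin.Base using (Fin)
import Data.List.Base as List
open import Data.List.Base using (List)
import Data.List.Relation.Binary.Disjoint.Setoid as DisjointSetoid
import Data.List.Relation.Unary.Unique.Setoid as UniqueSetoid
open import Data.Nat.Base as ℕ using (ℕ)
open import Data.Product.Base using (Σ; ∃; ∃-syntax; _×_; _,_; proj₁; proj₂)
open import Data.Sum.Base using (_⊎_; [_,_]′)
open import Data.Vec.Functional using (Vector; _++_)
open import Data.Vec.Functional.Relation.Binary.Equality.Setoid using (≋-setoid)
open import Function.Base using (_∘_)
open import Function.Bundles using (_⇔_; Injection)
open import Function.Definitions using (Injective)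
open import Level using (Level; suc; _⊔_)
open import Relation.Binary.Bundles using (Setoid)
open import Relation.Binary.Construct.Closure.ReflexiveTransitive using (Star; ε; _◅_)
open import Relation.Binary.Core using (Rel)
open import Relation.Binary.Definitions using (Irreflexive; Symmetric; _Respectsˡ_)
open import Relation.Binary.PropositionalEquality.Core using (_≡_; _≢_)
open import Relation.Binary.PropositionalEquality.Properties using (setoid)
open import Relation.Binary.Structures using (IsStrictPartialOrder)
open import Relation.Nullary.Negation using (¬_)
open import Relation.Unary using (Pred)

------------------------------------------------------------------------
-- Graphs

-- Finite or not; vertices are compared with the setoid equality.
record Graph v e r : Set (suc (v ⊔ e ⊔ r)) where
  infix 4 _~_
  field
    vertices : Setoid v e
  open Setoid vertices public using (_≈_) renaming (Carrier to Vertex)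
  field
    _~_      : Rel Vertex r
    ~-sym    : Symmetric _~_
    ~-irrefl : Irreflexive _≈_ _~_
    ~-respˡ  : _~_ Respectsˡ _≈_

module _ {v e r : Level} (G : Graph v e r) where
  open Graph G
  open UniqueSetoid vertices using (Unique)
  open DisjointSetoid vertices using (Disjoint)

  support : ∀ {x y} → Star _~_ x y → List Vertex
  support {x} ε       = List.[ x ]
  support {x} (_ ◅ w) = x List.∷ support w

  Path : Rel Vertex (v ⊔ e ⊔ r)
  Path x y = Σ (Star _~_ x y) (Unique ∘ support)

  -- A set of exactly 2k vertices partitioned into k pairs is given by its
  -- enumeration s₁, …, s_k, t₁, …, t_k without repetition.
  Linked : ℕ → Set (v ⊔ e ⊔ r)
  Linked k =
    Injection (setoid (Fin (2 ℕ.* k))) vertices ×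
    ((s t : Fin k → Vertex) → Injective _≡_ _≈_ [ s , t ]′ →
      Σ ((i : Fin k) → Path (s i) (t i)) λ L →
        ∀ {i j} → i ≢ j → Disjoint (support (proj₁ (L i))) (support (proj₁ (L j))))

------------------------------------------------------------------------
-- Ordered fields

-- Apartness is the constructive form of ≠, so that ℝ is an ordered field
-- without a decidable order.  Classically # is ≠ and this is the usual
-- notion: trichotomy is #⇔<⊎> and 0 < 1 is derivable.
record OrderedField c ℓ₁ ℓ₂ ℓ₃ : Set (suc (c ⊔ ℓ₁ ⊔ ℓ₂ ⊔ ℓ₃)) where
  field
    heytingField : HeytingField c ℓ₁ ℓ₂
  open HeytingField heytingField public
  infix 4 _<_ _≤_
  field
    _<_                  : Rel Carrier ℓ₃
    isStrictPartialOrder : IsStrictPartialOrder _≈_ _<_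
    #⇔<⊎>                : ∀ {x y} → x # y ⇔ (x < y ⊎ y < x)
    +-monoˡ-<            : ∀ z {x y} → x < y → x + z < y + z
    *-positive           : ∀ {x y} → 0# < x → 0# < y → 0# < x * y

  _≤_ : Rel Carrier ℓ₃
  x ≤ y = ¬ (y < x)

  commutativeRing : CommutativeRing c ℓ₁
  commutativeRing = record { isCommutativeRing = isCommutativeRing }

------------------------------------------------------------------------
-- Polytopes

module Polytopes {c ℓ₁ ℓ₂ ℓ₃ : Level} (𝔽 : OrderedField c ℓ₁ ℓ₂ ℓ₃) where

  private
    module F = OrderedField 𝔽
    S : Setoid c ℓ₁
    S = record { isEquivalence = F.isEquivalence }

  open F using (_+_; _*_; 0#; 1#; _≤_; _#_) renaming (Carrier to K; _≈_ to _≈ₖ_)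
  open SemiringSum (CommutativeRing.semiring F.commutativeRing) using (sum; sum-cong-≋)

  Point : ℕ → Set c
  Point = Vector K

  pointSetoid : ℕ → Setoid c ℓ₁
  pointSetoid = ≋-setoid S

  infix 4 _≋_
  _≋_ : ∀ {d} → Rel (Point d) ℓ₁
  _≋_ {d} = Setoid._≈_ (pointSetoid d)

  private module ≋ {d : ℕ} = Setoid (pointSetoid d)

  _·_ : ∀ {d} → Point d → Point d → K
  a · x = sum (λ i → a i * x i)

  combination : ∀ {n d} → (Fin n → K) → (Fin n → Point d) → Point d
  combination μ p k = sum (λ i → μ i * p i k)

  record Subset (d : ℕ) : Set (suc (c ⊔ ℓ₁ ⊔ ℓ₃)) where
    field
      member : Pred (Point d) (c ⊔ ℓ₁ ⊔ ℓ₃)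
      resp   : ∀ {x y} → x ≋ y → member x → member y

  infix 4 _∈_
  _∈_ : ∀ {d} → Point d → Subset d → Set (c ⊔ ℓ₁ ⊔ ℓ₃)
  x ∈ P = Subset.member P x

  conv : ∀ {n d} → (Fin n → Point d) → Subset d
  conv p = record
    { member = λ x → ∃[ μ ] (∀ i → 0# ≤ μ i) × sum μ ≈ₖ 1# × x ≋ combination μ p
    ; resp   = λ { x≋y (μ , μ≥0 , ∑μ≈1 , x≋μp) →
                   μ , μ≥0 , ∑μ≈1 , ≋.trans (≋.sym x≋y) x≋μp }
    }

  infixr 2 _×ˢ_
  _×ˢ_ : ∀ {d d′} → Subset d → Subset d′ → Subset (d ℕ.+ d′)
  P ×ˢ P′ = record
    { member = λ x → ∃[ p ] ∃[ p′ ] p ∈ P × p′ ∈ P′ × x ≋ p ++ p′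
    ; resp   = λ { x≋y (p , p′ , p∈P , p′∈P′ , x≋pp′) →
                   p , p′ , p∈P , p′∈P′ , ≋.trans (≋.sym x≋y) x≋pp′ }
    }

  -- Classically: ∑ μᵢ ≈ 0 and ∑ μᵢ pᵢ ≈ 0 imply that every μᵢ ≈ 0.
  AffinelyIndependent : ∀ {n d} → (Fin n → Point d) → Set (c ⊔ ℓ₁ ⊔ ℓ₂)
  AffinelyIndependent p =
    ∀ μ → sum μ ≈ₖ 0# → (∃[ i ] μ i # 0#) → ∃[ k ] combination μ p k # 0#

  record Simplex (d : ℕ) : Set (c ⊔ ℓ₁ ⊔ ℓ₂) where
    field
      points              : Fin (ℕ.suc d) → Point d
      affinelyIndependent : AffinelyIndependent points

    hull : Subset d
    hull = conv points

  -- The dimension of a set is that of its affine hull.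
  HasDimension : ∀ {d} → Subset d → ℕ → Set (c ⊔ ℓ₁ ⊔ ℓ₂ ⊔ ℓ₃)
  HasDimension {d} P k = Σ (Fin (ℕ.suc k) → Point d) λ p →
    (∀ i → p i ∈ P) ×
    AffinelyIndependent p ×
    (∀ x → x ∈ P → ∃[ μ ] sum μ ≈ₖ 1# × x ≋ combination μ p)

  -- A face is cut out by a valid inequality.  The zero normal is allowed, so
  -- P itself and the empty set are faces.
  record Face {d : ℕ} (P : Subset d) : Set (c ⊔ ℓ₁ ⊔ ℓ₃) where
    field
      normal : Point d
      offset : K
      valid  : ∀ x → x ∈ P → normal · x ≤ offset

    set : Subset d
    set = record
      { member = λ x → x ∈ P × normal · x ≈ₖ offset
      ; resp   = λ { x≋y (x∈P , ax≈b) →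
                     Subset.resp P x≋y x∈P ,
                     F.trans (sum-cong-≋ (λ i → F.*-congˡ (F.sym (x≋y i)))) ax≈b }
      }

  FaceOfDimension : ∀ {d} → ℕ → Subset d → Set (c ⊔ ℓ₁ ⊔ ℓ₂ ⊔ ℓ₃)
  FaceOfDimension k P = Σ (Face P) λ F → HasDimension (Face.set F) k

  IsVertex : ∀ {d} → Subset d → Pred (Point d) (c ⊔ ℓ₁ ⊔ ℓ₂ ⊔ ℓ₃)
  IsVertex P v = Σ (FaceOfDimension 0 P) λ (F , _) → v ∈ Face.set F

  graph : ∀ {d} → Subset d → Graph (c ⊔ ℓ₁ ⊔ ℓ₂ ⊔ ℓ₃) ℓ₁ (c ⊔ ℓ₁ ⊔ ℓ₂ ⊔ ℓ₃)
  graph {d} P = record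
    { vertices = record
      { Carrier       = ∃ (IsVertex P)
      ; _≈_           = λ u v → proj₁ u ≋ proj₁ v
      ; isEquivalence = record { refl = ≋.refl ; sym = ≋.sym ; trans = ≋.trans }
      }
    ; _~_      = λ (u , _) (v , _) →
                   ¬ (u ≋ v) ×
                   Σ (FaceOfDimension 1 P) λ (F , _) → u ∈ Face.set F × v ∈ Face.set F
    ; ~-sym    = λ (u≉v , F , u∈F , v∈F) → (λ v≋u → u≉v (≋.sym v≋u)) , F , v∈F , u∈F
    ; ~-irrefl = λ u≋v (u≉v , _) → u≉v u≋v
    ; ~-respˡ  = λ u≋u′ (u≉v , F , u∈F , v∈F) →
                   (λ u′≋v → u≉v (≋.trans u≋u′ u′≋v)) ,
                   F , Subset.resp (Face.set (proj₁ F)) u≋u′ u∈F , v∈F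
    }

{-# OPTIONS --safe #-}
module Submission where

-- Deleting a row lowers the bound m + n - 2 by one, so handing down every mark is not enough: the
-- number of marks has to fall as well. Dropping one of two equal labels leaves a label that occurs
-- once, which is why the induction allows labels without a partner. A mark in row `r` offers no
-- saving only if its partner lies in another row and another column `c′` and the cell (`r` , `c′`)
-- is itself marked; this is the second mark of the row. If every line were inhabited and held two
-- marks, there would be at least 2 max(m , n) ≥ m + n of them, too many. Joining a pair through the
-- empty column saves nothing at the first row, because the mark added in that column replaces the
-- one dropped. But it puts two equal labels into the second row, and deleting that row drops both:
-- two marks for two rows.

-- The graph of T(d₁) × T(d₂) is the rook's graph of a grid with m = d₁ + 1 rows and n = d₂ + 1
-- columns: vertices are cells, and two cells are adjacent when they lie on a common line.  A linkage
-- amounts to a colouring of cells in which the two terminals of each pair are joined inside their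
-- colour class.  Such a colouring exists for every marking of at most m + n - 2 cells by labels
-- occurring at most twice, by induction on m + n.  To delete a row, each of its marks is first handed
-- down to the other rows, within its own column or through a free cell of the row; this saves a mark
-- when two equal labels can be joined along the row.  If no row and no column allows a saving, then
-- every line containing a mark contains two, so by counting some line, say a column, is empty; the
-- two rows of any pair, joined through this column, can then be deleted together.
--
-- The order of the field is not decidable.  Faces are obtained from affine functions with prescribed
-- values at the vertices of a simplex, found by an induction without pivoting, and a vertex of the
-- product is located by the barycentric coordinates that are apart from zero.

open import Algebra.Bundles using (CommutativeMonoid; CommutativeRing)
import Algebra.Apartness.Properties.HeytingCommutativeRing as HeytingProperties
import Algebra.Properties.CommutativeMonoid.Sum as MonoidSum
import Algebra.Properties.CommutativeSemigroup as SemigroupProperties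
import Algebra.Properties.Ring as RingProperties
import Algebra.Properties.Semiring.Sum as SemiringSum
open import Data.Empty using (⊥-elim)
open import Data.Fin.Base
  using (Fin; zero; suc; punchIn; punchOut; _↑ˡ_; _↑ʳ_; splitAt; join; inject≤; remQuot; combine)
open import Data.Fin.Properties
  using (_≟_; any?; 0≢1+n; suc-injective; punchInᵢ≢i; punchIn-injective; punchIn-punchOut; splitAt-↑ˡ; splitAt-↑ʳ;
         join-splitAt; combine-remQuot; inject≤-injective)
open import Data.List.Base as List using (List)
open import Data.List.Membership.Propositional using (find) renaming (_∈_ to _∈ₗ_)
import Data.List.Membership.Setoid as Membership
import Data.List.Relation.Binary.Disjoint.Setoid as DisjointSetoid
import Data.List.Relation.Unary.All as All
import Data.List.Relation.Unary.All.Properties as All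
open import Data.List.Relation.Unary.AllPairs using () renaming (_∷_ to _∷ᵘ_; [] to []ᵘ)
open import Data.List.Relation.Unary.Any using (here; there)
import Data.List.Relation.Unary.Any as Any
import Data.List.Relation.Unary.Any.Properties as Any
open import Data.List.Relation.Unary.Unique.Propositional using (Unique)
import Data.List.Relation.Unary.Unique.Setoid as UniqueSetoid
import Data.List.Relation.Unary.Unique.Setoid.Properties as UniqueProperties
open import Data.Maybe.Base using (Maybe; just; nothing; maybe′)
open import Data.Maybe.Properties using (just-injective)
open import Data.Nat.Base as ℕᵇ using (ℕ; zero; suc; ⌊_/2⌋; ⌈_/2⌉)
import Data.Nat.Properties as ℕ
open import Data.Product.Base using (Σ; ∃; ∃-syntax; _×_; _,_; proj₁; proj₂)
open import Data.Product.Properties using (≡-dec)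
open import Data.Sum.Base using (_⊎_; inj₁; inj₂; [_,_]′; swap)
open import Data.Vec.Functional using (removeAt; insertAt; updateAt; _++_; _∷_; [])
open import Data.Vec.Functional.Properties
  using (updateAt-updates; updateAt-minimal; removeAt-punchOut; insertAt-lookup; insertAt-punchIn;
         lookup-++ˡ; lookup-++ʳ)
open import Function.Base using (_∘_; const; flip; id)
open import Function.Bundles using (Equivalence; Injection)
open import Function.Definitions using (Injective)
open import Level using (Level; _⊔_)
open import Relation.Binary.Bundles using (Setoid)
open import Relation.Binary.Construct.Closure.ReflexiveTransitive using (Star; ε; _◅_; gmap; reverse; return)
open import Relation.Binary.Core using (Rel)
open import Relation.Binary.Definitions using (DecidableEquality)
open import Relation.Binary.PropositionalEquality as ≡ using (_≡_; _≢_)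
open import Relation.Binary.Structures using (IsStrictPartialOrder)
open import Relation.Nullary using (¬_; Dec; yes; no; contradiction; ¬?)
open import Defs

-- Ordered fields with apartness and their finite sums

module SumSplit {c ℓ} (M : CommutativeMonoid c ℓ) where
  open CommutativeMonoid M
    renaming (_∙_ to _+_; assoc to +-assoc; identityˡ to +-identityˡ; ∙-congˡ to +-congˡ)
  open MonoidSum M

  sum-split : ∀ m {n} (f : Fin (m ℕᵇ.+ n) → Carrier) → sum f ≈ sum (f ∘ (_↑ˡ n)) + sum (f ∘ (m ↑ʳ_))
  sum-split zero    f = sym (+-identityˡ _)
  sum-split (suc m) f = trans (+-congˡ (sum-split m (f ∘ suc))) (sym (+-assoc _ _ _))

module OrderedFieldProperties {c ℓ₁ ℓ₂ ℓ₃ : Level} (𝔽 : OrderedField c ℓ₁ ℓ₂ ℓ₃) where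

  open OrderedField 𝔽 hiding (commutativeRing; zero) public
  open CommutativeRing (OrderedField.commutativeRing 𝔽) public
    using (ring; semiring; +-commutativeMonoid; +-commutativeSemigroup; *-commutativeSemigroup)
  open HeytingProperties heytingCommutativeRing public using (1#0; x#0y#0→xy#0; #-congʳ; x-0≈x)
  open RingProperties ring public using (-‿distribˡ-*; -‿distribʳ-*; -‿involutive; -0#≈0#)
  open IsStrictPartialOrder isStrictPartialOrder public
    using (<-respˡ-≈; <-respʳ-≈) renaming (trans to <-trans; irrefl to <-irrefl)
  open SemiringSum semiring public
  open SumSplit +-commutativeMonoid public
  open import Relation.Binary.Reasoning.Setoid (CommutativeRing.setoid (OrderedField.commutativeRing 𝔽)) public

  -‿cancelʳ : ∀ x y → x + (y - x) ≈ y
  -‿cancelʳ x y = begin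
    x + (y - x) ≈⟨ +-congˡ (+-comm y (- x)) ⟩
    x + (- x + y) ≈⟨ +-assoc x (- x) y ⟨
    (x - x) + y ≈⟨ +-congʳ (-‿inverseʳ x) ⟩
    0# + y ≈⟨ +-identityˡ y ⟩
    y ∎

  +-cancel-‿ : ∀ x y → (x + y) - y ≈ x
  +-cancel-‿ x y = trans (+-assoc x y (- y)) (trans (+-congˡ (-‿inverseʳ y)) (+-identityʳ x))

  <⇒# : ∀ {x y} → x < y → x # y
  <⇒# = Equivalence.from #⇔<⊎> ∘ inj₁

  #⇒<⊎> : ∀ {x y} → x # y → x < y ⊎ y < x
  #⇒<⊎> = Equivalence.to #⇔<⊎>

  <-cotrans : ∀ {x y} → x < y → ∀ z → x < z ⊎ z < y
  <-cotrans x<y z with #-cotrans (<⇒# x<y) z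
  ... | inj₁ x#z with #⇒<⊎> x#z
  ...   | inj₁ x<z = inj₁ x<z
  ...   | inj₂ z<x = inj₂ (<-trans z<x x<y)
  <-cotrans x<y z | inj₂ z#y with #⇒<⊎> z#y
  ...   | inj₁ z<y = inj₂ z<y
  ...   | inj₂ y<z = inj₁ (<-trans x<y y<z)

  ≈⇒≤ : ∀ {x y} → x ≈ y → x ≤ y
  ≈⇒≤ x≈y y<x = <-irrefl (sym x≈y) y<x

  <-cancelʳ : ∀ {x y} z → x + z < y + z → x < y
  <-cancelʳ {x} {y} z lt = <-respˡ-≈ (+-cancel-‿ x z) (<-respʳ-≈ (+-cancel-‿ y z) (+-monoˡ-< (- z) lt))

  ≤-#⇒< : ∀ {x} → 0# ≤ x → x # 0# → 0# < x
  ≤-#⇒< 0≤x x#0 with #⇒<⊎> x#0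
  ... | inj₁ x<0 = contradiction x<0 0≤x
  ... | inj₂ 0<x = 0<x

  +-nonneg : ∀ {x y} → 0# ≤ x → 0# ≤ y → 0# ≤ x + y
  +-nonneg {x} {y} 0≤x 0≤y x+y<0 with <-cotrans x+y<0 y
  ... | inj₁ x+y<y = 0≤x (<-cancelʳ y (<-respʳ-≈ (sym (+-identityˡ y)) x+y<y))
  ... | inj₂ y<0   = 0≤y y<0

  +-positive : ∀ {x y} → 0# < x → 0# ≤ y → 0# < x + y
  +-positive {x} {y} 0<x 0≤y with <-cotrans 0<x (x + y)
  ... | inj₁ 0<x+y = 0<x+y
  ... | inj₂ x+y<x = contradiction (<-cancelʳ x (<-respˡ-≈ (+-comm x y) (<-respʳ-≈ (sym (+-identityˡ x)) x+y<x))) 0≤y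

  #⇒inverse : ∀ {x} → x # 0# → ∃[ y ] y * x ≈ 1#
  #⇒inverse {x} x#0 with y , y*x-0≈1 , _ ← #⇒invertible x#0 = y , trans (*-congˡ (sym (x-0≈x x))) y*x-0≈1

  inverse⇒# : ∀ {x y} → y * x ≈ 1# → x # 0#
  inverse⇒# {x} {y} yx≈1 = invertible⇒#
    (y , trans (*-congˡ (x-0≈x x)) yx≈1 , trans (*-congʳ (x-0≈x x)) (trans (*-comm x y) yx≈1))

  difference-# : ∀ {x y} → x - y # 0# → x # y
  difference-# {x} {y} x-y#0 with z , z[x-y]≈1 ← #⇒inverse x-y#0 =
    invertible⇒# (z , z[x-y]≈1 , trans (*-comm (x - y) z) z[x-y]≈1)

  #-difference : ∀ {x y} → x # y → x - y # 0#
  #-difference x#y with _ , inverse , _ ← #⇒invertible x#y = inverse⇒# inverse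

  *-#ˡ : ∀ {x y} → x * y # 0# → x # 0#
  *-#ˡ {x} {y} xy#0 with z , zxy≈1 ← #⇒inverse xy#0 = inverse⇒# {y = z * y}
    (trans (*-assoc z y x) (trans (*-congˡ (*-comm y x)) zxy≈1))

  *-#ʳ : ∀ {x y} → x * y # 0# → y # 0#
  *-#ʳ {x} {y} xy#0 = *-#ˡ (#-congʳ (*-comm x y) xy#0)

  -- `≤` is a negation, so `x * y < 0#` has to be refuted. It makes the product apart from zero,
  -- hence both factors, and nonnegative factors apart from zero are positive.
  *-nonneg : ∀ {x y} → 0# ≤ x → 0# ≤ y → 0# ≤ x * y
  *-nonneg 0≤x 0≤y xy<0 = <-irrefl refl (<-trans xy<0 (*-positive (≤-#⇒< 0≤x (*-#ˡ xy#0)) (≤-#⇒< 0≤y (*-#ʳ xy#0))))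
    where
    xy#0 = <⇒# xy<0

  *-cancel-# : ∀ {x y} → x # 0# → x * y ≈ 0# → y ≈ 0#
  *-cancel-# {x} {y} x#0 xy≈0 with z , zx≈1 ← #⇒inverse x#0 = begin
    y           ≈⟨ *-identityˡ y ⟨
    1# * y      ≈⟨ *-congʳ zx≈1 ⟨
    z * x * y   ≈⟨ *-assoc z x y ⟩
    z * (x * y) ≈⟨ *-congˡ xy≈0 ⟩
    z * 0#      ≈⟨ zeroʳ z ⟩
    0#          ∎

  0<1 : 0# < 1#
  0<1 with #⇒<⊎> 1#0
  ... | inj₂ 0<1 = 0<1
  ... | inj₁ 1<0 = <-respʳ-≈ squared (*-positive 0<-1 0<-1)
    where
    0<-1 : 0# < - 1#
    0<-1 = <-respˡ-≈ (-‿inverseʳ 1#) (<-respʳ-≈ (+-identityˡ _) (+-monoˡ-< (- 1#) 1<0))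
    squared : - 1# * - 1# ≈ 1#
    squared = trans (sym (-‿distribˡ-* 1# (- 1#))) (trans (-‿cong (*-identityˡ (- 1#))) (-‿involutive 1#))

  nonneg-+≈0ˡ : ∀ {x y} → 0# ≤ x → 0# ≤ y → x + y ≈ 0# → x ≈ 0#
  nonneg-+≈0ˡ 0≤x 0≤y x+y≈0 = proj₁ (tight _ _) λ x#0 → <-irrefl (sym x+y≈0) (+-positive (≤-#⇒< 0≤x x#0) 0≤y)

  nonneg-+≈0ʳ : ∀ {x y} → 0# ≤ x → 0# ≤ y → x + y ≈ 0# → y ≈ 0#
  nonneg-+≈0ʳ 0≤x 0≤y x+y≈0 = nonneg-+≈0ˡ 0≤y 0≤x (trans (+-comm _ _) x+y≈0)

  sum-nonneg : ∀ {n} {f : Fin n → Carrier} → (∀ i → 0# ≤ f i) → 0# ≤ sum f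
  sum-nonneg {zero}  0≤f = ≈⇒≤ refl
  sum-nonneg {suc n} 0≤f = +-nonneg (0≤f zero) (sum-nonneg (0≤f ∘ suc))

  nonneg-sum≈0 : ∀ {n} {f : Fin n → Carrier} → (∀ i → 0# ≤ f i) → sum f ≈ 0# → ∀ i → f i ≈ 0#
  nonneg-sum≈0 0≤f ∑f≈0 zero    = nonneg-+≈0ˡ (0≤f zero) (sum-nonneg (0≤f ∘ suc)) ∑f≈0
  nonneg-sum≈0 0≤f ∑f≈0 (suc i) =
    nonneg-sum≈0 (0≤f ∘ suc) (nonneg-+≈0ʳ (0≤f zero) (sum-nonneg (0≤f ∘ suc)) ∑f≈0) i

  -- Cotransitivity compares the whole sum with the sum of its tail. This finds a weight apart from
  -- zero without deciding equality in the field.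
  sum-#0 : ∀ {n} (f : Fin n → Carrier) → sum f # 0# → ∃[ i ] f i # 0#
  sum-#0 {zero}  f ∑f#0 = contradiction ∑f#0 (#-irrefl refl)
  sum-#0 {suc n} f ∑f#0 with #-cotrans ∑f#0 (sum (f ∘ suc))
  ... | inj₂ rest#0 with i , fi#0 ← sum-#0 (f ∘ suc) rest#0 = suc i , fi#0
  ... | inj₁ ∑f#rest = zero , Equivalence.from #⇔<⊎> (cancel (#⇒<⊎> ∑f#rest))
    where
    rest = sum (f ∘ suc)
    cancel : f zero + rest < rest ⊎ rest < f zero + rest → f zero < 0# ⊎ 0# < f zero
    cancel (inj₁ lt) = inj₁ (<-cancelʳ rest (<-respʳ-≈ (sym (+-identityˡ rest)) lt))
    cancel (inj₂ lt) = inj₂ (<-cancelʳ rest (<-respˡ-≈ (sym (+-identityˡ rest)) lt))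

  sum-zero : ∀ {n} {f : Fin n → Carrier} → (∀ i → f i ≈ 0#) → sum f ≈ 0#
  sum-zero {n} f≈0 = trans (sum-cong-≋ f≈0) (sum-replicate-zero n)

  sum-single : ∀ {n} {f : Fin n → Carrier} i → (∀ j → j ≢ i → f j ≈ 0#) → sum f ≈ f i
  sum-single {suc n} {f} i f≈0 = begin
    sum f                    ≈⟨ sum-remove {i = i} f ⟩
    f i + sum (removeAt f i) ≈⟨ +-congˡ (sum-zero (λ j → f≈0 _ (punchInᵢ≢i i j))) ⟩
    f i + 0#                 ≈⟨ +-identityʳ _ ⟩
    f i                      ∎

  sum-pair : ∀ {n} {f : Fin n → Carrier} {i j} → i ≢ j → (∀ k → k ≢ i → k ≢ j → f k ≈ 0#) → sum f ≈ f i + f j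
  sum-pair {suc n} {f} {i} {j} i≢j f≈0 = begin
    sum f                    ≈⟨ sum-remove {i = i} f ⟩
    f i + sum (removeAt f i) ≈⟨ +-congˡ (sum-single (punchOut i≢j) λ k k≢ → f≈0 _ (punchInᵢ≢i i k) λ eq →
        k≢ (punchIn-injective i _ _ (≡.trans eq (≡.sym (punchIn-punchOut i≢j))))) ⟩
    f i + removeAt f i (punchOut i≢j) ≈⟨ +-congˡ (reflexive (removeAt-punchOut f i≢j)) ⟩
    f i + f j                ∎

  indicator : ∀ {p} {P : Set p} → Dec P → Carrier
  indicator (yes _) = 1#
  indicator (no _)  = 0#

  unit : ∀ {n} → Fin n → Fin n → Carrier
  unit i j = indicator (j ≟ i)

  unit-same : ∀ {n} (i : Fin n) → unit i i ≈ 1#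
  unit-same i with i ≟ i
  ... | yes _  = refl
  ... | no i≢i = contradiction ≡.refl i≢i

  unit-other : ∀ {n} {i j : Fin n} → j ≢ i → unit i j ≈ 0#
  unit-other {i = i} {j} j≢i with j ≟ i
  ... | yes j≡i = contradiction j≡i j≢i
  ... | no _    = refl

  sum-unit : ∀ {n} (i : Fin n) → sum (unit i) ≈ 1#
  sum-unit i = trans (sum-single i (λ j → unit-other)) (unit-same i)

  sum-unit-* : ∀ {n} (i : Fin n) (f : Fin n → Carrier) → sum (λ j → unit i j * f j) ≈ f i
  sum-unit-* i f = begin
    sum (λ j → unit i j * f j) ≈⟨ sum-single i (λ j j≢i → trans (*-congʳ (unit-other j≢i)) (zeroˡ (f j))) ⟩
    unit i i * f i             ≈⟨ *-congʳ (unit-same i) ⟩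
    1# * f i                   ≈⟨ *-identityˡ (f i) ⟩
    f i                        ∎

  indicator-nonneg : ∀ {p} {P : Set p} (d : Dec P) → 0# ≤ indicator d
  indicator-nonneg (yes _) 1<0 = <-irrefl refl (<-trans 0<1 1<0)
  indicator-nonneg (no _)      = ≈⇒≤ refl

-- Affine functions on simplices

module Geometry {c ℓ₁ ℓ₂ ℓ₃ : Level} (𝔽 : OrderedField c ℓ₁ ℓ₂ ℓ₃) where

  open OrderedFieldProperties 𝔽
  open Polytopes 𝔽

  ·-congʳ : ∀ {d} (a : Point d) {x y : Point d} → x ≋ y → a · x ≈ a · y
  ·-congʳ a x≋y = sum-cong-≋ λ k → *-congˡ (x≋y k)

  ·-+ : ∀ {d} (a x y : Point d) → a · (λ k → x k + y k) ≈ a · x + a · y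
  ·-+ a x y = trans (sum-cong-≋ λ k → distribˡ (a k) (x k) (y k)) (∑-distrib-+ (λ k → a k * x k) (λ k → a k * y k))

  ·-combination : ∀ {n d} (a : Point d) (μ : Fin n → Carrier) (p : Fin n → Point d) →
    a · combination μ p ≈ sum (λ i → μ i * (a · p i))
  ·-combination a μ p = begin
    sum (λ k → a k * sum (λ i → μ i * p i k))   ≈⟨ sum-cong-≋ (λ k → *-distribˡ-sum (a k) (λ i → μ i * p i k)) ⟩
    sum (λ k → sum (λ i → a k * (μ i * p i k))) ≈⟨ ∑-comm (λ k i → a k * (μ i * p i k)) ⟩
    sum (λ i → sum (λ k → a k * (μ i * p i k))) ≈⟨ sum-cong-≋ (λ i → sum-cong-≋ λ k → x∙yz≈y∙xz (a k) (μ i) (p i k)) ⟩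
    sum (λ i → sum (λ k → μ i * (a k * p i k))) ≈⟨ sum-cong-≋ (λ i → *-distribˡ-sum (μ i) (λ k → a k * p i k)) ⟨
    sum (λ i → μ i * (a · p i))                 ∎
    where open SemigroupProperties *-commutativeSemigroup using (x∙yz≈y∙xz)

  ·-split : ∀ {d d′} (a z : Point (d ℕᵇ.+ d′)) →
    a · z ≈ (a ∘ (_↑ˡ d′)) · (z ∘ (_↑ˡ d′)) + (a ∘ (d ↑ʳ_)) · (z ∘ (d ↑ʳ_))
  ·-split {d} a z = sum-split d (λ k → a k * z k)

  ·-++ʳ : ∀ {d d′} (a : Point (d ℕᵇ.+ d′)) (x : Point d) (y : Point d′) →
    a · (x ++ y) ≈ (a ∘ (_↑ˡ d′)) · x + (a ∘ (d ↑ʳ_)) · y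
  ·-++ʳ {d} {d′} a x y = trans (·-split {d} {d′} a (x ++ y)) (+-cong
    (·-congʳ (a ∘ (_↑ˡ _)) (reflexive ∘ lookup-++ˡ x y)) (·-congʳ (a ∘ (d ↑ʳ_)) (reflexive ∘ lookup-++ʳ x y)))

  ·-++ : ∀ {d d′} (a x : Point d) (b y : Point d′) → (a ++ b) · (x ++ y) ≈ a · x + b · y
  ·-++ a x b y = trans (·-++ʳ (a ++ b) x y) (+-cong
    (sum-cong-≋ λ k → *-congʳ (reflexive (lookup-++ˡ a b k))) (sum-cong-≋ λ k → *-congʳ (reflexive (lookup-++ʳ a b k))))

  Linear : ∀ {d} → (Point d → Carrier) → Set _
  Linear φ = ∃ λ a → ∀ x → a · x ≈ φ x

  linear-coordinate : ∀ {d} (k : Fin d) → Linear (λ x → x k)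
  linear-coordinate k = unit k , sum-unit-* k

  linear-+ : ∀ {d} {φ ψ : Point d → Carrier} → Linear φ → Linear ψ → Linear (λ x → φ x + ψ x)
  linear-+ (a , a≈φ) (b , b≈ψ) = (λ k → a k + b k) , λ x → begin
    sum (λ k → (a k + b k) * x k)       ≈⟨ sum-cong-≋ (λ k → distribʳ (x k) (a k) (b k)) ⟩
    sum (λ k → a k * x k + b k * x k)   ≈⟨ ∑-distrib-+ (λ k → a k * x k) (λ k → b k * x k) ⟩
    a · x + b · x                       ≈⟨ +-cong (a≈φ x) (b≈ψ x) ⟩
    _ ∎

  linear-* : ∀ {d} {φ : Point d → Carrier} r → Linear φ → Linear (λ x → r * φ x)
  linear-* r (a , a≈φ) = (λ k → r * a k) , λ x → begin
    sum (λ k → r * a k * x k)   ≈⟨ sum-cong-≋ (λ k → *-assoc r (a k) (x k)) ⟩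
    sum (λ k → r * (a k * x k)) ≈⟨ *-distribˡ-sum r (λ k → a k * x k) ⟨
    r * (a · x)                 ≈⟨ *-congˡ (a≈φ x) ⟩
    _ ∎

  linear-sum : ∀ {n d} {φ : Fin n → Point d → Carrier} → (∀ i → Linear (φ i)) → Linear (λ x → sum (λ i → φ i x))
  linear-sum {zero}  lin = (λ _ → 0#) , λ x → sum-zero λ k → zeroˡ (x k)
  linear-sum {suc n} lin = linear-+ (lin zero) (linear-sum (lin ∘ suc))

  LinearlyIndependent : ∀ {n d} → (Fin n → Point d) → Set _
  LinearlyIndependent v = ∀ μ → (∃[ i ] μ i # 0#) → ∃[ k ] combination μ v k # 0#

  -- Prescribing -1 at vᵢ and 0 at the other vectors after v₀ gives functionals gᵢ.  The combination
  -- v₀ + ∑ gᵢ(v₀) vᵢ has a coordinate k apart from 0, so x ↦ xₖ + ∑ gᵢ(x) vᵢₖ vanishes at v₁, v₂, …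
  -- but not at v₀.  No pivot has to be chosen.
  interpolate : ∀ {n d} (v : Fin n → Point d) → LinearlyIndependent v →
    (h : Fin n → Carrier) → ∃ λ (a : Point d) → ∀ i → a · v i ≈ h i
  interpolate {zero}  v ind h = (λ _ → 0#) , λ ()
  interpolate {suc n} {d} v ind h = proj₁ linear-ψ , λ i → trans (proj₂ linear-ψ (v i)) (ψ≈h i)
    where
    tail-ind : LinearlyIndependent (v ∘ suc)
    tail-ind μ (i , μi#0) with k , wk#0 ← ind (0# ∷ μ) (suc i , μi#0) =
      k , #-congʳ (trans (+-congʳ (zeroˡ (v zero k))) (+-identityˡ _)) wk#0

    g : Fin n → Point d
    g i = proj₁ (interpolate (v ∘ suc) tail-ind (λ j → - unit i j))

    g-value : ∀ i j → g i · v (suc j) ≈ - unit i j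
    g-value i = proj₂ (interpolate (v ∘ suc) tail-ind (λ j → - unit i j))

    w : Fin d → Carrier
    w = combination (1# ∷ λ i → g i · v zero) v

    apart : ∃[ k ] w k # 0#
    apart = ind (1# ∷ λ i → g i · v zero) (zero , 1#0)
    k = proj₁ apart

    r = proj₁ (#⇒inverse (proj₂ apart))

    θ : Point d → Carrier
    θ x = r * (x k + sum (λ i → v (suc i) k * (g i · x)))

    linear-θ : Linear θ
    linear-θ = linear-* r (linear-+ (linear-coordinate k)
      (linear-sum λ i → linear-* (v (suc i) k) (g i , λ _ → refl)))

    θ-zero : θ (v zero) ≈ 1#
    θ-zero = trans (*-congˡ (+-cong (sym (*-identityˡ (v zero k)))
      (sum-cong-≋ λ i → *-comm (v (suc i) k) (g i · v zero))))
      (proj₂ (#⇒inverse (proj₂ apart)))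

    θ-suc : ∀ j → θ (v (suc j)) ≈ 0#
    θ-suc j = trans (*-congˡ (begin
      v (suc j) k + sum (λ i → v (suc i) k * (g i · v (suc j))) ≈⟨ +-congˡ (sum-single j λ i i≢j → trans (*-congˡ
          (trans (g-value i j) (trans (-‿cong (unit-other (i≢j ∘ ≡.sym))) -0#≈0#))) (zeroʳ _)) ⟩
      v (suc j) k + v (suc j) k * (g j · v (suc j)) ≈⟨ +-congˡ (*-congˡ (trans (g-value j j) (-‿cong (unit-same j)))) ⟩
      v (suc j) k + v (suc j) k * - 1#              ≈⟨ +-congˡ (-‿distribʳ-* (v (suc j) k) 1#) ⟨
      v (suc j) k - v (suc j) k * 1#                ≈⟨ +-congˡ (-‿cong (*-identityʳ _)) ⟩
      v (suc j) k - v (suc j) k                     ≈⟨ -‿inverseʳ _ ⟩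
      0#                                            ∎)) (zeroʳ r)

    b = proj₁ (interpolate (v ∘ suc) tail-ind (h ∘ suc))

    -- `θ` is 1 at `v zero` and 0 at the later vectors, so adding `s * θ` corrects the value at
    -- `v zero` and keeps the values already achieved by `b`.
    s = h zero - b · v zero

    linear-ψ : Linear (λ x → b · x + s * θ x)
    linear-ψ = linear-+ (b , λ _ → refl) (linear-* s linear-θ)

    ψ≈h : ∀ i → b · v i + s * θ (v i) ≈ h i
    ψ≈h zero    = trans (+-congˡ (trans (*-congˡ θ-zero) (*-identityʳ s))) (-‿cancelʳ (b · v zero) (h zero))
    ψ≈h (suc j) = trans (+-cong (proj₂ (interpolate (v ∘ suc) tail-ind (h ∘ suc)) j)
      (trans (*-congˡ (θ-suc j)) (zeroʳ s))) (+-identityʳ (h (suc j)))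

  -- A combination of the differences is a combination of the points with total weight zero: the
  -- base point receives `- sum μ`.
  differences-independent : ∀ {n d} (p : Fin (suc n) → Point d) → AffinelyIndependent p →
    LinearlyIndependent (λ i k → p (suc i) k - p zero k)
  differences-independent {n} p ind μ (i , μi#0)
    with k , wk#0 ← ind ((- sum μ) ∷ μ) (-‿inverseˡ (sum μ)) (suc i , μi#0) =
    k , #-congʳ (begin
      - sum μ * p zero k + sum (λ i → μ i * p (suc i) k)  ≈⟨ +-comm _ _ ⟩
      sum (λ i → μ i * p (suc i) k) + - sum μ * p zero k  ≈⟨ +-congˡ
          (trans (sym (-‿distribˡ-* (sum μ) (p zero k))) (-‿distribʳ-* (sum μ) (p zero k))) ⟩
      sum (λ i → μ i * p (suc i) k) + sum μ * - p zero k  ≈⟨ +-congˡ (*-distribʳ-sum (- p zero k) μ) ⟩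
      sum (λ i → μ i * p (suc i) k) + sum (λ i → μ i * - p zero k) ≈⟨ ∑-distrib-+
          (λ i → μ i * p (suc i) k) (λ i → μ i * - p zero k) ⟨
      sum (λ i → μ i * p (suc i) k + μ i * - p zero k)    ≈⟨ sum-cong-≋ (λ i → distribˡ (μ i) (p (suc i) k) (- p zero k)) ⟨
      sum (λ i → μ i * (p (suc i) k - p zero k))          ∎) wk#0

  -- An affine function with prescribed values is written as a·x + h ≈ b, the form in which a
  -- valid inequality and its slack h appear.
  affine-interpolate : ∀ {n d} (p : Fin (suc n) → Point d) → AffinelyIndependent p →
    (h : Fin (suc n) → Carrier) → ∃ λ (a : Point d) → ∃[ b ] (∀ i → a · p i + h i ≈ b)
  affine-interpolate {n} {d} p ind h = a , a · p zero + h zero , values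
    where
    v : Fin n → Point d
    v i k = p (suc i) k - p zero k
    solution = interpolate v (differences-independent p ind) (λ i → h zero - h (suc i))
    a = proj₁ solution
    values : ∀ i → a · p i + h i ≈ a · p zero + h zero
    values zero    = refl
    values (suc i) = begin
      a · p (suc i) + h (suc i)              ≈⟨ +-congʳ (·-congʳ a λ k → -‿cancelʳ (p zero k) (p (suc i) k)) ⟨
      a · (λ k → p zero k + v i k) + h (suc i) ≈⟨ +-congʳ (·-+ a (p zero) (v i)) ⟩
      a · p zero + a · v i + h (suc i)       ≈⟨ +-assoc _ _ _ ⟩
      a · p zero + (a · v i + h (suc i))     ≈⟨ +-congˡ (trans (+-comm _ _)
          (trans (+-congˡ (proj₂ solution i)) (-‿cancelʳ (h (suc i)) (h zero)))) ⟩
      a · p zero + h zero                    ∎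

  slack-combination : ∀ {n d} {a : Point d} {b} {p : Fin n → Point d} {h : Fin n → Carrier} →
    (∀ i → a · p i + h i ≈ b) →
    ∀ {μ x} → sum μ ≈ 1# → x ≋ combination μ p → a · x + sum (λ i → μ i * h i) ≈ b
  slack-combination {a = a} {b} {p} {h} values {μ} {x} ∑μ≈1 x≋ = begin
    a · x + sum (λ i → μ i * h i)                             ≈⟨ +-congʳ (trans (·-congʳ a x≋) (·-combination a μ p)) ⟩
    sum (λ i → μ i * (a · p i)) + sum (λ i → μ i * h i)       ≈⟨ ∑-distrib-+ (λ i → μ i * (a · p i)) (λ i → μ i * h i) ⟨
    sum (λ i → μ i * (a · p i) + μ i * h i)                   ≈⟨ sum-cong-≋ (λ i → distribˡ (μ i) (a · p i) (h i)) ⟨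
    sum (λ i → μ i * (a · p i + h i))                         ≈⟨ sum-cong-≋ (λ i → *-congˡ (values i)) ⟩
    sum (λ i → μ i * b)                                       ≈⟨ *-distribʳ-sum b μ ⟨
    sum μ * b                                                 ≈⟨ *-congʳ ∑μ≈1 ⟩
    1# * b                                                    ≈⟨ *-identityˡ b ⟩
    b                                                         ∎

  slack-nonneg : ∀ {x s b} → x + s ≈ b → x ≤ b → 0# ≤ s
  slack-nonneg {x} {s} x+s≈b x≤b s<0 =
    x≤b (<-respˡ-≈ (trans (+-comm s x) x+s≈b) (<-respʳ-≈ (+-identityˡ x) (+-monoˡ-< x s<0)))

  nonneg-slack : ∀ {x s b} → x + s ≈ b → 0# ≤ s → x ≤ b
  nonneg-slack {x} {s} {b} x+s≈b 0≤s b<x =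
    0≤s (<-cancelʳ x (<-respˡ-≈ (trans (sym x+s≈b) (+-comm x s)) (<-respʳ-≈ (sym (+-identityˡ x)) b<x)))

  slack-zero : ∀ {x s b} → x + s ≈ b → x ≈ b → s ≈ 0#
  slack-zero {x} {s} {b} x+s≈b x≈b = begin
    s             ≈⟨ +-cancel-‿ s x ⟨
    (s + x) - x   ≈⟨ +-cong (trans (+-comm s x) x+s≈b) (-‿cong x≈b) ⟩
    b - b         ≈⟨ -‿inverseʳ b ⟩
    0#            ∎

  zero-slack : ∀ {x s b} → x + s ≈ b → s ≈ 0# → x ≈ b
  zero-slack {x} x+s≈b s≈0 = trans (sym (trans (+-congˡ s≈0) (+-identityʳ x))) x+s≈b

  module ≋ {d} = Setoid (pointSetoid d)

  ++-cong : ∀ {d d′} {x x′ : Point d} {y y′ : Point d′} → x ≋ x′ → y ≋ y′ → x ++ y ≋ x′ ++ y′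
  ++-cong {d} x≋ y≋ k with splitAt d k
  ... | inj₁ i = x≋ i
  ... | inj₂ j = y≋ j

  ++-cancelˡ : ∀ {d d′} (x x′ : Point d) (y y′ : Point d′) → x ++ y ≋ x′ ++ y′ → x ≋ x′
  ++-cancelˡ x x′ y y′ eq k =
    trans (reflexive (≡.sym (lookup-++ˡ x y k))) (trans (eq (k ↑ˡ _)) (reflexive (lookup-++ˡ x′ y′ k)))

  ++-cancelʳ : ∀ {d d′} (x x′ : Point d) (y y′ : Point d′) → x ++ y ≋ x′ ++ y′ → y ≋ y′
  ++-cancelʳ {d} x x′ y y′ eq k =
    trans (reflexive (≡.sym (lookup-++ʳ x y k))) (trans (eq (d ↑ʳ k)) (reflexive (lookup-++ʳ x′ y′ k)))

  combination-++ : ∀ {n d d′} (κ : Fin n → Carrier) (a : Fin n → Point d) (b : Fin n → Point d′) →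
    combination κ (λ t → a t ++ b t) ≋ combination κ a ++ combination κ b
  combination-++ {d = d} κ a b k with splitAt d k
  ... | inj₁ i = refl
  ... | inj₂ j = refl

  combination-const : ∀ {n d} (κ : Fin n → Carrier) (a : Fin n → Point d) {x} → sum κ ≈ 1# → (∀ t → a t ≋ x) →
    x ≋ combination κ a
  combination-const κ a {x} ∑κ≈1 a≋x k = begin
    x k                       ≈⟨ *-identityˡ (x k) ⟨
    1# * x k                  ≈⟨ *-congʳ ∑κ≈1 ⟨
    sum κ * x k               ≈⟨ *-distribʳ-sum (x k) κ ⟩
    sum (λ t → κ t * x k)     ≈⟨ sum-cong-≋ (λ t → *-congˡ (a≋x t k)) ⟨
    sum (λ t → κ t * a t k)   ∎

  point∈conv : ∀ {n d} (p : Fin n → Point d) i → p i ∈ conv p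
  point∈conv p i = unit i , (λ j → indicator-nonneg (j ≟ i)) , sum-unit i , λ k → sym (sum-unit-* i (λ j → p j k))

  Apart : ∀ {d} → Point d → Point d → Set _
  Apart x y = ∃[ k ] x k # y k

  apart⇒≉ : ∀ {d} {x y : Point d} → Apart x y → ¬ (x ≋ y)
  apart⇒≉ (k , xk#yk) x≋y = #-irrefl (x≋y k) xk#yk

  apart-++ˡ : ∀ {d d′} {x x′ : Point d} {y y′ : Point d′} → Apart x x′ → Apart (x ++ y) (x′ ++ y′)
  apart-++ˡ {x = x} {x′} {y} {y′} (k , xk#x′k) =
    k ↑ˡ _ , ≡.subst₂ _#_ (≡.sym (lookup-++ˡ x y k)) (≡.sym (lookup-++ˡ x′ y′ k)) xk#x′k

  apart-++ʳ : ∀ {d d′} {x x′ : Point d} {y y′ : Point d′} → Apart y y′ → Apart (x ++ y) (x′ ++ y′)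
  apart-++ʳ {d} {x = x} {x′} {y} {y′} (k , yk#y′k) =
    d ↑ʳ k , ≡.subst₂ _#_ (≡.sym (lookup-++ʳ x y k)) (≡.sym (lookup-++ʳ x′ y′ k)) yk#y′k

  -- The weights 1 at `i` and -1 at `j` have sum zero, so independence yields a coordinate in which
  -- their combination, the difference of the two points, is apart from zero.
  independent⇒apart : ∀ {n d} {p : Fin n → Point d} → AffinelyIndependent p → ∀ {i j} → i ≢ j → Apart (p i) (p j)
  independent⇒apart {n} {d} {p} ind {i} {j} i≢j =
    proj₁ apart , difference-# (#-congʳ (value (proj₁ apart)) (proj₂ apart))
    where
    μ : Fin n → Carrier
    μ l = unit i l + - 1# * unit j l
    -1* : ∀ x → - 1# * x ≈ - x
    -1* x = trans (sym (-‿distribˡ-* 1# x)) (-‿cong (*-identityˡ x))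
    μi#0 : μ i # 0#
    μi#0 = #-congʳ (sym (trans (+-cong (unit-same i) (trans (*-congˡ (unit-other i≢j)) (zeroʳ _))) (+-identityʳ 1#))) 1#0
    ∑μ≈0 : sum μ ≈ 0#
    ∑μ≈0 = begin
      sum μ                                        ≈⟨ ∑-distrib-+ (unit i) (λ l → - 1# * unit j l) ⟩
      sum (unit i) + sum (λ l → - 1# * unit j l)   ≈⟨ +-cong (sum-unit i) (sym (*-distribˡ-sum (- 1#) (unit j))) ⟩
      1# + - 1# * sum (unit j)                     ≈⟨ +-congˡ (trans (-1* _) (-‿cong (sum-unit j))) ⟩
      1# - 1#                                      ≈⟨ -‿inverseʳ 1# ⟩
      0#                                           ∎
    apart : ∃[ k ] combination μ p k # 0#
    apart = ind μ ∑μ≈0 (i , μi#0)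
    value : ∀ k → combination μ p k ≈ p i k - p j k
    value k = begin
      sum (λ l → μ l * p l k)                                        ≈⟨ sum-cong-≋
        (λ l → distribʳ (p l k) (unit i l) (- 1# * unit j l)) ⟩
      sum (λ l → unit i l * p l k + - 1# * unit j l * p l k)         ≈⟨ ∑-distrib-+
        (λ l → unit i l * p l k) (λ l → - 1# * unit j l * p l k) ⟩
      sum (λ l → unit i l * p l k) + sum (λ l → - 1# * unit j l * p l k) ≈⟨ +-cong (sum-unit-* i (λ l → p l k)) (begin
        sum (λ l → - 1# * unit j l * p l k)   ≈⟨ sum-cong-≋ (λ l → *-assoc (- 1#) (unit j l) (p l k)) ⟩
        sum (λ l → - 1# * (unit j l * p l k)) ≈⟨ *-distribˡ-sum (- 1#) (λ l → unit j l * p l k) ⟨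
        - 1# * sum (λ l → unit j l * p l k)   ≈⟨ -1* _ ⟩
        - sum (λ l → unit j l * p l k)        ≈⟨ -‿cong (sum-unit-* j (λ l → p l k)) ⟩
        - p j k                               ∎) ⟩
      p i k - p j k                           ∎

  one-point-independent : ∀ {d} (p : Fin 1 → Point d) → AffinelyIndependent p
  one-point-independent p μ ∑μ≈0 (zero , μ0#0) =
    contradiction μ0#0 (#-irrefl (trans (sym (+-identityʳ (μ zero))) ∑μ≈0))

  two-points-independent : ∀ {d} (p : Fin 2 → Point d) → Apart (p zero) (p (suc zero)) → AffinelyIndependent p
  two-points-independent p (k , p₀#p₁) μ ∑μ≈0 some =
    k , #-congʳ (sym value) (x#0y#0→xy#0 (first some) (#-difference p₀#p₁))
    where
    μ₀ = μ zero
    μ₁ = μ (suc zero)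
    μ₁≈-μ₀ : μ₁ ≈ - μ₀
    μ₁≈-μ₀ = begin
      μ₁                  ≈⟨ +-cancel-‿ μ₁ μ₀ ⟨
      (μ₁ + μ₀) - μ₀      ≈⟨ +-congʳ (trans (+-comm μ₁ μ₀) (trans (+-congˡ (sym (+-identityʳ μ₁))) ∑μ≈0)) ⟩
      0# - μ₀             ≈⟨ +-identityˡ _ ⟩
      - μ₀                ∎
    first : ∃[ i ] μ i # 0# → μ₀ # 0#
    first (zero , μ₀#0) = μ₀#0
    first (suc zero , μ₁#0) = *-#ˡ (#-congʳ (begin
      μ₁          ≈⟨ μ₁≈-μ₀ ⟩
      - μ₀        ≈⟨ -‿cong (*-identityʳ μ₀) ⟨
      - (μ₀ * 1#) ≈⟨ -‿distribʳ-* μ₀ 1# ⟩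
      μ₀ * - 1#   ∎) μ₁#0)
    value : combination μ p k ≈ μ₀ * (p zero k - p (suc zero) k)
    value = begin
      μ₀ * p zero k + (μ₁ * p (suc zero) k + 0#) ≈⟨ +-congˡ (+-identityʳ _) ⟩
      μ₀ * p zero k + μ₁ * p (suc zero) k        ≈⟨ +-congˡ (*-congʳ μ₁≈-μ₀) ⟩
      μ₀ * p zero k + - μ₀ * p (suc zero) k      ≈⟨ +-congˡ (trans (sym (-‿distribˡ-* μ₀ _)) (-‿distribʳ-* μ₀ _)) ⟩
      μ₀ * p zero k + μ₀ * - p (suc zero) k      ≈⟨ distribˡ μ₀ _ _ ⟨
      μ₀ * (p zero k - p (suc zero) k)           ∎

  Supported : ∀ {k n} → (Fin k → Fin n) → (Fin n → Carrier) → Set _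
  Supported σ ν = ∀ i → (∀ t → σ t ≢ i) → ν i ≈ 0#

  record Barycentric {k n d} (σ : Fin k → Fin n) (p : Fin n → Point d) (x : Point d) : Set (c ⊔ ℓ₁) where
    field
      weights   : Fin n → Carrier
      total     : sum weights ≈ 1#
      value     : x ≋ combination weights p
      supported : Supported σ weights

  barycentric-constant : ∀ {k n d} {σ : Fin k → Fin n} {p : Fin n → Point d} {x i} → (∀ t → σ t ≡ i) →
    Barycentric σ p x → x ≋ p i
  barycentric-constant {p = p} {x} {i} σ≡i B k = begin
    x k                               ≈⟨ value k ⟩
    sum (λ j → weights j * p j k)     ≈⟨ sum-single i (λ j j≢i → trans (*-congʳ (off j j≢i)) (zeroˡ _)) ⟩
    weights i * p i k                 ≈⟨ *-congʳ (trans (sym (sum-single i off)) total) ⟩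
    1# * p i k                        ≈⟨ *-identityˡ _ ⟩
    p i k                             ∎
    where
    open Barycentric B
    off : ∀ j → j ≢ i → weights j ≈ 0#
    off j j≢i = supported j λ t σt≡j → j≢i (≡.trans (≡.sym σt≡j) (σ≡i t))

  barycentric-pair : ∀ {n d} {σ : Fin 2 → Fin n} {p : Fin n → Point d} {x} → σ zero ≢ σ (suc zero) →
    Barycentric σ p x → ∃[ κ ] sum κ ≈ 1# × x ≋ combination κ (p ∘ σ)
  barycentric-pair {n} {σ = σ} {p} {x} σ₀≢σ₁ B = weights ∘ σ , trans (sym (restrict weights supported)) total ,
    λ k → trans (value k) (restrict (λ j → weights j * p j k) λ i ∉σ → trans (*-congʳ (supported i ∉σ)) (zeroˡ _))
    where
    open Barycentric B
    restrict : (f : Fin n → Carrier) → Supported σ f → sum f ≈ sum (f ∘ σ)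
    restrict f off = trans
      (sum-pair σ₀≢σ₁ λ k k≢σ₀ k≢σ₁ → off k λ { zero eq → k≢σ₀ (≡.sym eq) ; (suc zero) eq → k≢σ₁ (≡.sym eq) })
      (+-congˡ (sym (+-identityʳ _)))

  -- Prescribed as the slack at the vertices of a simplex: the resulting valid inequality is tight
  -- exactly at the vertices listed by `σ` and cuts out the face that they span.
  outside : ∀ {k n} → (Fin k → Fin n) → Fin n → Carrier
  outside σ i = indicator (¬? (any? λ t → σ t ≟ i))

  outside-image : ∀ {k n} (σ : Fin k → Fin n) t → outside σ (σ t) ≈ 0#
  outside-image σ t with any? (λ t′ → σ t′ ≟ σ t)
  ... | yes _ = refl
  ... | no ∉σ = contradiction (t , ≡.refl) ∉σ

  outside-rest : ∀ {k n} (σ : Fin k → Fin n) i → (∀ t → σ t ≢ i) → outside σ i ≈ 1#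
  outside-rest σ i ∉σ with any? (λ t → σ t ≟ i)
  ... | yes (t , eq) = contradiction eq (∉σ t)
  ... | no _         = refl

  -- Vertices and edges of a product of two simplices

  module Product {m n d d′} {p : Fin (suc m) → Point d} (p-ind : AffinelyIndependent p)
    {q : Fin (suc n) → Point d′} (q-ind : AffinelyIndependent q) where

    P : Subset (d ℕᵇ.+ d′)
    P = conv p ×ˢ conv q

    r : Fin (suc m) × Fin (suc n) → Point (d ℕᵇ.+ d′)
    r (i , j) = p i ++ q j

    r∈P : ∀ u → r u ∈ P
    r∈P (i , j) = p i , q j , point∈conv p i , point∈conv q j , ≋.refl

    r-apart : ∀ {u v} → u ≢ v → Apart (r u) (r v)
    r-apart {i , j} {i′ , j′} u≢v with i ≟ i′
    ... | no i≢i′    = apart-++ˡ (independent⇒apart p-ind i≢i′)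
    ... | yes ≡.refl = apart-++ʳ (independent⇒apart q-ind (λ j≡j′ → u≢v (≡.cong (i ,_) j≡j′)))

    r-injective : ∀ {u v} → r u ≋ r v → u ≡ v
    r-injective {u} {v} ru≋rv with ≡-dec _≟_ _≟_ u v
    ... | yes u≡v = u≡v
    ... | no u≢v  = contradiction ru≋rv (apart⇒≉ (r-apart u≢v))

    slack-++ : ∀ {a : Point d} {a′ : Point d′} {x y s s′ b b′} → a · x + s ≈ b → a′ · y + s′ ≈ b′ →
      (a ++ a′) · (x ++ y) + (s + s′) ≈ b + b′
    slack-++ {a} {a′} {x} {y} {s} {s′} eq eq′ = trans (+-congʳ (·-++ a x a′ y))
      (trans (interchange (a · x) (a′ · y) s s′) (+-cong eq eq′))
      where open SemigroupProperties +-commutativeSemigroup using (interchange)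

    -- Adding the inequalities of two faces cuts out their product. In general this is larger than
    -- the affine span of the points `r (σ t , τ t)`, so `faceOfDimension` asks for weights `κ`
    -- common to both factors.
    module SpannedFace {k} (σ : Fin (suc k) → Fin (suc m)) (τ : Fin (suc k) → Fin (suc n)) where

      private
        first  = affine-interpolate p p-ind (outside σ)
        second = affine-interpolate q q-ind (outside τ)
        a  = proj₁ first
        a′ = proj₁ second
        b  = proj₁ (proj₂ first)
        b′ = proj₁ (proj₂ second)

        slack : ∀ {z x y} (μ : Fin (suc m) → Carrier) (ν : Fin (suc n) → Carrier) →
          sum μ ≈ 1# → x ≋ combination μ p → sum ν ≈ 1# → y ≋ combination ν q → z ≋ x ++ y →
          (a ++ a′) · z + (sum (λ i → μ i * outside σ i) + sum (λ j → ν j * outside τ j)) ≈ b + b′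
        slack {z} {x} {y} μ ν ∑μ x≋ ∑ν y≋ z≋ = trans (+-congʳ (·-congʳ (a ++ a′) z≋))
          (slack-++ {a} {a′} {x} {y} (slack-combination {h = outside σ} (proj₂ (proj₂ first)) {μ} ∑μ x≋)
                    (slack-combination {h = outside τ} (proj₂ (proj₂ second)) {ν} ∑ν y≋))

        terms-nonneg : ∀ {l N} (ρ : Fin l → Fin N) (μ : Fin N → Carrier) → (∀ i → 0# ≤ μ i) → ∀ i → 0# ≤ μ i * outside ρ i
        terms-nonneg ρ μ 0≤μ i = *-nonneg (0≤μ i) (indicator-nonneg (¬? (any? λ t → ρ t ≟ i)))

        barycentric : ∀ {l N D} (ρ : Fin l → Fin N) {w : Fin N → Point D} {x} (μ : Fin N → Carrier) →
          (∀ i → 0# ≤ μ i) → sum μ ≈ 1# →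
          x ≋ combination μ w → sum (λ i → μ i * outside ρ i) ≈ 0# → Barycentric ρ w x
        barycentric ρ μ 0≤μ ∑μ x≋ ∑≈0 = record
          { weights = μ ; total = ∑μ ; value = x≋ ; supported = λ i ∉ρ → begin
              μ i                ≈⟨ *-identityʳ (μ i) ⟨
              μ i * 1#           ≈⟨ *-congˡ (outside-rest ρ i ∉ρ) ⟨
              μ i * outside ρ i  ≈⟨ nonneg-sum≈0 (terms-nonneg ρ μ 0≤μ) ∑≈0 i ⟩
              0#                 ∎ }

      face : Face P
      face = record
        { normal = a ++ a′
        ; offset = b + b′
        ; valid  = λ { z (x , y , (μ , 0≤μ , ∑μ , x≋) , (ν , 0≤ν , ∑ν , y≋) , z≋) →
            nonneg-slack (slack μ ν ∑μ x≋ ∑ν y≋ z≋)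
              (+-nonneg (sum-nonneg (terms-nonneg σ μ 0≤μ)) (sum-nonneg (terms-nonneg τ ν 0≤ν))) }
        }

      contains : ∀ t → r (σ t , τ t) ∈ Face.set face
      contains t = r∈P (σ t , τ t) , zero-slack
        (slack-++ {a} {a′} {p (σ t)} {q (τ t)} (proj₂ (proj₂ first) (σ t)) (proj₂ (proj₂ second) (τ t)))
        (trans (+-cong (outside-image σ t) (outside-image τ t)) (+-identityˡ 0#))

      spread : ∀ z → z ∈ Face.set face → ∃[ x ] ∃[ y ] z ≋ x ++ y × Barycentric σ p x × Barycentric τ q y
      spread z ((x , y , (μ , 0≤μ , ∑μ , x≋) , (ν , 0≤ν , ∑ν , y≋) , z≋) , az≈b) =
        x , y , z≋
        , barycentric σ μ 0≤μ ∑μ x≋ (nonneg-+≈0ˡ 0≤s 0≤s′ s+s′≈0)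
        , barycentric τ ν 0≤ν ∑ν y≋ (nonneg-+≈0ʳ 0≤s 0≤s′ s+s′≈0)
        where
        0≤s  = sum-nonneg (terms-nonneg σ μ 0≤μ)
        0≤s′ = sum-nonneg (terms-nonneg τ ν 0≤ν)
        s+s′≈0 = slack-zero (slack μ ν ∑μ x≋ ∑ν y≋ z≋) az≈b

      faceOfDimension : AffinelyIndependent (λ t → r (σ t , τ t)) →
        (∀ {x y} → Barycentric σ p x → Barycentric τ q y →
          ∃[ κ ] sum κ ≈ 1# × x ≋ combination κ (p ∘ σ) × y ≋ combination κ (q ∘ τ)) →
        FaceOfDimension k P
      faceOfDimension ind spans = face , (λ t → r (σ t , τ t)) , contains , ind , λ z z∈F → spanned z (spread z z∈F)
        where
        spanned : ∀ z → ∃[ x ] ∃[ y ] z ≋ x ++ y × Barycentric σ p x × Barycentric τ q y →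
          ∃[ κ ] sum κ ≈ 1# × z ≋ combination κ (λ t → r (σ t , τ t))
        spanned z (x , y , z≋ , Bx , By) with κ , ∑κ , x≋ , y≋ ← spans Bx By =
          κ , ∑κ , ≋.trans z≋ (≋.trans (++-cong x≋ y≋) (≋.sym (combination-++ κ (p ∘ σ) (q ∘ τ))))

    isVertex : ∀ u → IsVertex P (r u)
    isVertex u@(i , j) = faceOfDimension (one-point-independent (λ _ → r u)) spans , contains zero
      where
      open SpannedFace {0} (const i) (const j)
      spans : ∀ {x y} → Barycentric (const i) p x → Barycentric (const j) q y →
        ∃[ κ ] sum κ ≈ 1# × x ≋ combination κ (const (p i)) × y ≋ combination κ (const (q j))
      spans Bx By = const 1# , +-identityʳ 1#
        , ≋.trans (barycentric-constant (λ _ → ≡.refl) Bx)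
            (combination-const {1} (const 1#) (const (p i)) (+-identityʳ 1#) (λ _ → ≋.refl))
        , ≋.trans (barycentric-constant (λ _ → ≡.refl) By)
            (combination-const {1} (const 1#) (const (q j)) (+-identityʳ 1#) (λ _ → ≋.refl))

    -- On a common line one of the two factor faces is a single vertex. Any weights of total 1
    -- represent that vertex, so the weights of the other factor serve for both.
    edge : ∀ {i j i′ j′} → i ≡ i′ ⊎ j ≡ j′ → (i , j) ≢ (i′ , j′) →
      Σ (FaceOfDimension 1 P) λ (F , _) → r (i , j) ∈ Face.set F × r (i′ , j′) ∈ Face.set F
    edge {i} {j} {i′} {j′} line u≢v =
      faceOfDimension (two-points-independent (λ t → r (σ t , τ t)) (r-apart u≢v)) (spans line) ,
      contains zero , contains (suc zero)
      where
      σ : Fin 2 → Fin (suc m)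
      σ = i ∷ i′ ∷ []
      τ : Fin 2 → Fin (suc n)
      τ = j ∷ j′ ∷ []
      open SpannedFace σ τ
      spans : i ≡ i′ ⊎ j ≡ j′ → ∀ {x y} → Barycentric σ p x → Barycentric τ q y →
        ∃[ κ ] sum κ ≈ 1# × x ≋ combination κ (p ∘ σ) × y ≋ combination κ (q ∘ τ)
      spans (inj₁ i≡i′) Bx By
        with κ , ∑κ , y≋ ← barycentric-pair (λ j≡j′ → u≢v (≡.cong₂ _,_ i≡i′ j≡j′)) By =
        κ , ∑κ , ≋.trans (barycentric-constant σ≡i Bx)
          (combination-const κ (p ∘ σ) ∑κ λ t → ≋.reflexive (≡.cong p (σ≡i t))) , y≋
        where
        σ≡i : ∀ t → σ t ≡ i
        σ≡i zero       = ≡.refl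
        σ≡i (suc zero) = ≡.sym i≡i′
      spans (inj₂ j≡j′) Bx By
        with κ , ∑κ , x≋ ← barycentric-pair (λ i≡i′ → u≢v (≡.cong₂ _,_ i≡i′ j≡j′)) Bx =
        κ , ∑κ , x≋ , ≋.trans (barycentric-constant τ≡j By)
          (combination-const κ (q ∘ τ) ∑κ λ t → ≋.reflexive (≡.cong q (τ≡j t)))
        where
        τ≡j : ∀ t → τ t ≡ j
        τ≡j zero       = ≡.refl
        τ≡j (suc zero) = ≡.sym j≡j′

    -- If v = (x, y) is a vertex and pᵢ has positive weight in x, then (pᵢ, y) lies on the face {v}.
    vertex≋r : ∀ {v} → IsVertex P v → ∃[ u ] v ≋ r u
    vertex≋r {v}
      ((F , v₀ , v₀∈F , _ , unique) ,
       v∈F@((x , y , x∈@(μ , 0≤μ , ∑μ , x≋) , y∈@(ν , 0≤ν , ∑ν , y≋) , v≋xy) , _)) =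
      (i , j) , ≋.trans v≋xy (++-cong
        (≋.sym (++-cancelˡ (p i) x y y (≋.trans (≋F pᵢy∈F) v≋xy)))
        (≋.sym (++-cancelʳ x x (q j) y (≋.trans (≋F xqⱼ∈F) v≋xy))))
      where
      open Face F
      ≋v₀ : ∀ {z} → z ∈ Face.set F → z ≋ v₀ zero
      ≋v₀ z∈F with κ , ∑κ , z≋ ← unique _ z∈F = ≋.trans z≋ (≋.sym (combination-const κ v₀ ∑κ λ { zero → ≋.refl }))
      ≋F : ∀ {z} → z ∈ Face.set F → z ≋ v
      ≋F z∈F = ≋.trans (≋v₀ z∈F) (≋.sym (≋v₀ v∈F))
      positive : ∀ {N} (κ : Fin N → Carrier) → sum κ ≈ 1# → ∃[ t ] κ t # 0#
      positive κ ∑κ = sum-#0 κ (#-congʳ (sym ∑κ) 1#0)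
      i = proj₁ (positive μ ∑μ)
      j = proj₁ (positive ν ∑ν)
      xy∈F : normal · (x ++ y) ≈ offset
      xy∈F = trans (sym (·-congʳ normal v≋xy)) (proj₂ v∈F)
      left : Point d
      left = normal ∘ (_↑ˡ d′)
      right : Point d′
      right = normal ∘ (d ↑ʳ_)
      complement : ∀ z → normal · z + (offset - normal · z) ≈ offset
      complement z = -‿cancelʳ (normal · z) offset
      -- The slack of the inequality is affine along `lift` and nonnegative at the lifted vertices;
      -- its average with weights `κ` is the slack at `lift s`, which is zero. So each term
      -- `κ t * h t` vanishes, and a weight apart from zero cancels.
      tight-point : ∀ {N D} {w : Fin N → Point D} (a : Point D) (rest : Carrier) (lift : Point D → Point (d ℕᵇ.+ d′)) →
        (∀ s → normal · lift s ≈ a · s + rest) → (∀ t → lift (w t) ∈ P) →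
        ∀ {κ s} → (∀ t → 0# ≤ κ t) → sum κ ≈ 1# → s ≋ combination κ w → normal · lift s ≈ offset →
        ∀ t → κ t # 0# → lift (w t) ∈ Face.set F
      tight-point {w = w} a rest lift split lift∈P {κ} {s} 0≤κ ∑κ s≋ tight-s t κt#0 = lift∈P t ,
        zero-slack (complement (lift (w t))) (*-cancel-# κt#0 (nonneg-sum≈0 terms ∑≈0 t))
        where
        h = λ t → offset - normal · lift (w t)
        terms : ∀ t → 0# ≤ κ t * h t
        terms t = *-nonneg (0≤κ t) (slack-nonneg (complement (lift (w t))) (valid _ (lift∈P t)))
        affine : ∀ t → a · w t + h t ≈ offset - rest
        affine t = begin
          a · w t + h t                          ≈⟨ +-cancel-‿ _ rest ⟨
          a · w t + h t + rest - rest            ≈⟨ +-congʳ (xy∙z≈xz∙y (a · w t) (h t) rest) ⟩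
          a · w t + rest + h t - rest            ≈⟨ +-congʳ (+-congʳ (split (w t))) ⟨
          normal · lift (w t) + h t - rest       ≈⟨ +-congʳ (complement (lift (w t))) ⟩
          offset - rest                          ∎
          where open SemigroupProperties +-commutativeSemigroup using (xy∙z≈xz∙y)
        ∑≈0 : sum (λ t → κ t * h t) ≈ 0#
        ∑≈0 = slack-zero (slack-combination {a = a} {h = h} affine ∑κ s≋)
          (trans (sym (+-cancel-‿ (a · s) rest)) (+-congʳ (trans (sym (split s)) tight-s)))
      pᵢy∈F : p i ++ y ∈ Face.set F
      pᵢy∈F = tight-point left (right · y) (_++ y) (λ s → ·-++ʳ normal s y) (λ t → p t , y , point∈conv p t , y∈ , ≋.refl)
        0≤μ ∑μ x≋ xy∈F i (proj₂ (positive μ ∑μ))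
      xqⱼ∈F : x ++ q j ∈ Face.set F
      xqⱼ∈F = tight-point right (left · x) (x ++_) (λ s → trans (·-++ʳ normal x s) (+-comm _ _))
        (λ t → x , q t , x∈ , point∈conv q t , ≋.refl) 0≤ν ∑ν y≋ xy∈F j (proj₂ (positive ν ∑ν))

    adjacent : (x y : Graph.Vertex (graph P)) → ∀ u v → proj₁ x ≋ r u → proj₁ y ≋ r v →
      proj₁ u ≡ proj₁ v ⊎ proj₂ u ≡ proj₂ v → u ≢ v → Graph._~_ (graph P) x y
    adjacent (x , _) (y , _) u v x≋ y≋ line u≢v =
      (λ x≋y → u≢v (r-injective (≋.trans (≋.sym x≋) (≋.trans x≋y y≋)))) ,
      proj₁ e , Subset.resp F (≋.sym x≋) (proj₁ (proj₂ e)) , Subset.resp F (≋.sym y≋) (proj₂ (proj₂ e))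
      where
      e : Σ (FaceOfDimension 1 P) λ (F , _) → r u ∈ Face.set F × r v ∈ Face.set F
      e = edge line u≢v
      F = Face.set (proj₁ (proj₁ e))

-- Sums of natural numbers

open ℕᵇ using (_+_; _*_; _≤_; _<_; z≤n; s≤s) renaming (_⊔_ to _⊔ⁿ_)
open ≡ using (refl; sym; trans; cong; cong₂; subst; subst₂; ≢-sym; setoid; module ≡-Reasoning)
open MonoidSum ℕ.+-0-commutativeMonoid using (sum; sum-remove; sum-cong-≗; ∑-comm; ∑-distrib-+)

search : ∀ {a b n} {A : Fin n → Set a} {B : Fin n → Set b} →
  (∀ i → A i ⊎ B i) → ∃ A ⊎ (∀ i → B i)
search {n = zero}  f = inj₂ λ ()
search {n = suc n} f with f zero | search (f ∘ suc)
... | inj₁ a | _            = inj₁ (zero , a)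
... | inj₂ _ | inj₁ (i , a) = inj₁ (suc i , a)
... | inj₂ b | inj₂ bs      = inj₂ λ { zero → b ; (suc i) → bs i }

punchIn-view : ∀ {n} (i j : Fin (suc n)) → j ≡ i ⊎ ∃ λ k → j ≡ punchIn i k
punchIn-view i j with i ≟ j
... | yes i≡j = inj₁ (sym i≡j)
... | no  i≢j = inj₂ (punchOut i≢j , sym (punchIn-punchOut i≢j))

sum-mono : ∀ {n} {f g : Fin n → ℕ} → (∀ i → f i ≤ g i) → sum f ≤ sum g
sum-mono {zero}  f≤g = z≤n
sum-mono {suc n} f≤g = ℕ.+-mono-≤ (f≤g zero) (sum-mono (f≤g ∘ suc))

sum-mono-+ : ∀ {n} {f g : Fin n → ℕ} k → (∀ i → f i ≤ g i) → ∀ i → k + f i ≤ g i → k + sum f ≤ sum g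
sum-mono-+ {suc n} {f} {g} k f≤g i gap = begin
  k + sum f                        ≡⟨ cong (k +_) (sum-remove {i = i} f) ⟩
  k + (f i + sum (removeAt f i))   ≡⟨ ℕ.+-assoc k (f i) _ ⟨
  k + f i + sum (removeAt f i)     ≤⟨ ℕ.+-mono-≤ gap (sum-mono (f≤g ∘ punchIn i)) ⟩
  g i + sum (removeAt g i)         ≡⟨ sum-remove {i = i} g ⟨
  sum g                            ∎
  where open ℕ.≤-Reasoning

sum-mono-<₂ : ∀ {n} {f g : Fin n → ℕ} → (∀ i → f i ≤ g i) →
  ∀ {i j} → i ≢ j → f i < g i → f j < g j → 2 + sum f ≤ sum g
sum-mono-<₂ {suc n} {f} {g} f≤g {i} {j} i≢j fi<gi fj<gj = begin
  2 + sum f                          ≡⟨ cong (2 +_) (sum-remove {i = i} f) ⟩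
  2 + (f i + sum (removeAt f i))     ≡⟨ cong suc (ℕ.+-suc (f i) _) ⟨
  suc (f i) + suc (sum (removeAt f i)) ≤⟨ ℕ.+-mono-≤ fi<gi (sum-mono-+ 1 (f≤g ∘ punchIn i) (punchOut i≢j)
      (subst₂ _<_ (sym (removeAt-punchOut f i≢j)) (sym (removeAt-punchOut g i≢j)) fj<gj)) ⟩
  g i + sum (removeAt g i)           ≡⟨ sum-remove {i = i} g ⟨
  sum g                              ∎
  where open ℕ.≤-Reasoning

-- Changing one summand, stated with additions on both sides to avoid truncated subtraction. The
-- counts of a grid altered in one cell rest on it.
sum-replace : ∀ {n} {f g : Fin n → ℕ} i → (∀ j → j ≢ i → f j ≡ g j) → sum f + g i ≡ sum g + f i
sum-replace {suc n} {f} {g} i f≡g = begin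
  sum f + g i                      ≡⟨ cong (_+ g i) (sum-remove {i = i} f) ⟩
  f i + sum (removeAt f i) + g i   ≡⟨ cong (λ s → f i + s + g i) (sum-cong-≗ λ j → f≡g _ (punchInᵢ≢i i j)) ⟩
  f i + sum (removeAt g i) + g i   ≡⟨ ℕ.+-comm _ (g i) ⟩
  g i + (f i + sum (removeAt g i)) ≡⟨ cong (g i +_) (ℕ.+-comm (f i) _) ⟩
  g i + (sum (removeAt g i) + f i) ≡⟨ ℕ.+-assoc (g i) _ _ ⟨
  g i + sum (removeAt g i) + f i   ≡⟨ cong (_+ f i) (sum-remove {i = i} g) ⟨
  sum g + f i                      ∎
  where open ≡-Reasoning

sum-const : ∀ {n} {f : Fin n → ℕ} k → (∀ i → f i ≡ k) → sum f ≡ n * k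
sum-const {zero}  k f≡k = refl
sum-const {suc n} k f≡k = cong₂ _+_ (f≡k zero) (sum-const k (f≡k ∘ suc))

term≤sum : ∀ {n} (f : Fin n → ℕ) i → f i ≤ sum f
term≤sum {suc n} f i = ℕ.≤-trans (ℕ.m≤m+n (f i) _) (ℕ.≤-reflexive (sym (sum-remove {i = i} f)))

size≤sum : ∀ {n} {f : Fin n → ℕ} → (∀ i → 1 ≤ f i) → n ≤ sum f
size≤sum {zero}  1≤f = z≤n
size≤sum {suc n} 1≤f = ℕ.+-mono-≤ (1≤f zero) (size≤sum (1≤f ∘ suc))

-- Each of the other terms contributes at least one. This is the pigeonhole estimate that provides a
-- free column in `evacuate`.
term+size≤sum : ∀ {n} {f : Fin n → ℕ} → (∀ i → 1 ≤ f i) → ∀ i → f i + n ≤ suc (sum f)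
term+size≤sum {suc n} {f} 1≤f i = begin
  f i + suc n                    ≡⟨ ℕ.+-suc (f i) n ⟩
  suc (f i + n)                  ≤⟨ s≤s (ℕ.+-monoʳ-≤ (f i) (size≤sum (1≤f ∘ punchIn i))) ⟩
  suc (f i + sum (removeAt f i)) ≡⟨ cong suc (sum-remove {i = i} f) ⟨
  suc (sum f)                    ∎
  where open ℕ.≤-Reasoning

infixl 10 _[_≔_]
_[_≔_] : ∀ {a} {A : Set a} {n} → (Fin n → A) → Fin n → A → Fin n → A
xs [ i ≔ v ] = updateAt xs i (const v)

module _ {a} {A : Set a} {n} {xs : Fin n → A} {v : A} where

  ≔-same : ∀ i → (xs [ i ≔ v ]) i ≡ v
  ≔-same i = updateAt-updates i xs

  ≔-other : ∀ {i j} → j ≢ i → (xs [ i ≔ v ]) j ≡ xs j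
  ≔-other {i} {j} = updateAt-minimal j i xs

-- Markings of a grid and their weighted counts

module Knitting (L : Set) (_≟ᴸ_ : DecidableEquality L) where

  Marked : Maybe L → Set
  Marked a = ∃ λ ℓ → a ≡ just ℓ

  marked? : ∀ a → a ≡ nothing ⊎ Marked a
  marked? nothing  = inj₁ refl
  marked? (just ℓ) = inj₂ (ℓ , refl)

  Grid : ℕ → ℕ → Set
  Grid m n = Fin m → Fin n → Maybe L

  Extends : ∀ {m n} → Grid m n → Grid m n → Set
  Extends χ μ = ∀ r c ℓ → μ r c ≡ just ℓ → χ r c ≡ just ℓ

  weight : (L → ℕ) → Maybe L → ℕ
  weight g = maybe′ g 0

  one : L → ℕ
  one _ = 1

  height : ∀ {m n} → Grid m n → Fin n → ℕ
  height μ x = sum (λ z → weight one (μ z x))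

  -- The weight `g` covers two quantities at once: `one` counts all marks and `δ ℓ` the occurrences
  -- of `ℓ`. A law proved for every `g` maintains both bounds of the induction.
  count : ∀ {m n} → (L → ℕ) → Grid m n → ℕ
  count g μ = sum (λ z → sum (weight g ∘ μ z))

  mark : ∀ {m n} → Grid m n → Fin m → Fin n → L → Grid m n
  mark μ z x ℓ = μ [ z ≔ μ z [ x ≔ just ℓ ] ]

  module _ {m n} {μ : Grid m n} {z : Fin m} {x : Fin n} {ℓ : L} where

    mark-same : mark μ z x ℓ z x ≡ just ℓ
    mark-same = trans (cong (λ row → row x) (≔-same {xs = μ} z)) (≔-same {xs = μ z} x)

    mark-otherʳ : ∀ {z′} → z′ ≢ z → mark μ z x ℓ z′ ≡ μ z′
    mark-otherʳ = ≔-other {xs = μ}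

    mark-otherᶜ : ∀ z′ {x′} → x′ ≢ x → mark μ z x ℓ z′ x′ ≡ μ z′ x′
    mark-otherᶜ z′ {x′} x′≢x with z′ ≟ z
    ... | yes refl = trans (cong (λ row → row x′) (≔-same {xs = μ} z)) (≔-other {xs = μ z} x′≢x)
    ... | no z′≢z  = cong (λ row → row x′) (mark-otherʳ z′≢z)

    module _ (free : μ z x ≡ nothing) where

      mark-extends : Extends (mark μ z x ℓ) μ
      mark-extends z′ x′ ℓ′ eq with x′ ≟ x | z′ ≟ z
      ... | no x′≢x  | _        = trans (mark-otherᶜ z′ x′≢x) eq
      ... | yes _    | no z′≢z  = trans (cong (λ row → row x′) (mark-otherʳ z′≢z)) eq
      ... | yes refl | yes refl with () ← trans (sym eq) free

      height-mark : height (mark μ z x ℓ) x ≡ suc (height μ x)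
      height-mark = begin
        height (mark μ z x ℓ) x                              ≡⟨ ℕ.+-identityʳ _ ⟨
        height (mark μ z x ℓ) x + 0                          ≡⟨ cong (λ a → height (mark μ z x ℓ) x + weight one a) free ⟨
        height (mark μ z x ℓ) x + weight one (μ z x)         ≡⟨ sum-replace z
          (λ z′ z′≢z → cong (λ row → weight one (row x)) (mark-otherʳ z′≢z)) ⟩
        height μ x + weight one (mark μ z x ℓ z x)           ≡⟨ cong (λ a → height μ x + weight one a) mark-same ⟩
        height μ x + 1                                       ≡⟨ ℕ.+-comm _ 1 ⟩
        suc (height μ x)                                     ∎
        where open ≡-Reasoning

      count-mark : ∀ g → count g (mark μ z x ℓ) ≡ count g μ + g ℓ
      count-mark g = ℕ.+-cancelʳ-≡ (row μ) _ _ (begin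
        count g (mark μ z x ℓ) + row μ  ≡⟨ sum-replace z (λ z′ z′≢z → cong (λ r → sum (weight g ∘ r)) (mark-otherʳ z′≢z)) ⟩
        count g μ + row (mark μ z x ℓ)  ≡⟨ cong (count g μ +_) row-mark ⟩
        count g μ + (g ℓ + row μ)       ≡⟨ ℕ.+-assoc (count g μ) (g ℓ) (row μ) ⟨
        count g μ + g ℓ + row μ         ∎)
        where
        open ≡-Reasoning
        row : Grid m n → ℕ
        row μ′ = sum (weight g ∘ μ′ z)
        row-mark : row (mark μ z x ℓ) ≡ g ℓ + row μ
        row-mark = begin
          row (mark μ z x ℓ)                          ≡⟨ ℕ.+-identityʳ _ ⟨
          row (mark μ z x ℓ) + 0                      ≡⟨ cong (λ a → row (mark μ z x ℓ) + weight g a) free ⟨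
          row (mark μ z x ℓ) + weight g (μ z x)       ≡⟨ sum-replace x (λ x′ x′≢x → cong (weight g) (mark-otherᶜ z x′≢x)) ⟩
          row μ + weight g (mark μ z x ℓ z x)         ≡⟨ cong (λ a → row μ + weight g a) mark-same ⟩
          row μ + g ℓ                                 ≡⟨ ℕ.+-comm _ (g ℓ) ⟩
          g ℓ + row μ                                 ∎

    height-mark-other : ∀ {x′} → x′ ≢ x → height (mark μ z x ℓ) x′ ≡ height μ x′
    height-mark-other x′≢x = sum-cong-≗ λ z′ → cong (weight one) (mark-otherᶜ z′ x′≢x)

  -- A cell of the row to be deleted: a token is a label not yet handed down to the other rows.
  data State : Set where
    free  : State
    used  : L → State
    token : L → State

  hue : State → Maybe L
  hue free      = nothing
  hue (used ℓ)  = just ℓ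
  hue (token ℓ) = just ℓ

  load : (L → ℕ) → State → ℕ
  load g (token ℓ) = g ℓ
  load g _         = 0

  -- Both moves of a token (exit and move below) preserve the potential, the sum of Φ over all
  -- columns, where w counts the marks of the column outside the row.  As long as it is less than
  -- (number of columns) + (number of other rows), a column full of marks holding a token leaves
  -- another column free and unmarked.
  Φ : State → ℕ → ℕ
  Φ free      w = w
  Φ (used _)  w = 1 ⊔ⁿ w
  Φ (token _) w = suc w

  potential : ∀ {m n} → (Fin n → State) → Grid m n → ℕ
  potential row μ = sum (λ x → Φ (row x) (height μ x))

  -- `colours` colours the deleted row and `marks` is the marking left to the other rows. `exits`
  -- names a column where the label of a token appears both in the row and below it. `gains` records
  -- the trace of a token in its original column; it gives the slack for deleting a second row.
  record Evacuation {m n} (row : Fin n → State) (μ : Grid m n) : Set where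
    field
      colours  : Fin n → Maybe L
      marks    : Grid m n
      coloured : ∀ x ℓ → hue (row x) ≡ just ℓ → colours x ≡ just ℓ
      extends  : Extends marks μ
      counts   : ∀ g → count g marks ≡ count g μ + sum (load g ∘ row)
      exits    : ∀ {x ℓ} → row x ≡ token ℓ → ∃[ y ] ∃[ z ] colours y ≡ just ℓ × marks z y ≡ just ℓ
      gains    : ∀ {x ℓ} → row x ≡ token ℓ →
                 (∃[ z ] μ z x ≡ nothing × Marked (marks z x)) ⊎ (∀ z → Marked (marks z x))

  Extends-marked : ∀ {m n} {χ μ : Grid m n} → Extends χ μ → ∀ z x → Marked (μ z x) → Marked (χ z x)
  Extends-marked ext z x (ℓ , eq) = ℓ , ext z x ℓ eq

  Extends-nothing : ∀ {m n} {χ μ : Grid m n} → Extends χ μ → ∀ z x → χ z x ≡ nothing → μ z x ≡ nothing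
  Extends-nothing {μ = μ} ext z x χzx with marked? (μ z x)
  ... | inj₁ μzx = μzx
  ... | inj₂ (ℓ , μzx) with () ← trans (sym (ext z x ℓ μzx)) χzx

  Extends-trans : ∀ {m n} {χ ψ μ : Grid m n} → Extends χ ψ → Extends ψ μ → Extends χ μ
  Extends-trans e₁ e₂ r c ℓ eq = e₁ r c ℓ (e₂ r c ℓ eq)

  -- The two moves of a token

  module _ {n} (row : Fin n → State) {x : Fin n} {ℓ : L} (tok : row x ≡ token ℓ) where

    load-used : ∀ g → load g (token ℓ) + sum (load g ∘ row [ x ≔ used ℓ ]) ≡ sum (load g ∘ row)
    load-used g = begin
      g ℓ + sum (load g ∘ row [ x ≔ used ℓ ]) ≡⟨ ℕ.+-comm (g ℓ) _ ⟩
      sum (load g ∘ row [ x ≔ used ℓ ]) + g ℓ ≡⟨ cong (λ s → sum (load g ∘ row [ x ≔ used ℓ ]) + load g s) tok ⟨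
      sum (load g ∘ row [ x ≔ used ℓ ]) + load g (row x)
        ≡⟨ sum-replace x (λ y y≢x → cong (load g) (≔-other {xs = row} y≢x)) ⟩
      sum (load g ∘ row) + load g ((row [ x ≔ used ℓ ]) x) ≡⟨
        cong (λ s → sum (load g ∘ row) + load g s) (≔-same {xs = row} x) ⟩
      sum (load g ∘ row) + 0                  ≡⟨ ℕ.+-identityʳ _ ⟩
      sum (load g ∘ row)                      ∎
      where open ≡-Reasoning

    hue-used : ∀ y → hue ((row [ x ≔ used ℓ ]) y) ≡ hue (row y)
    hue-used y with y ≟ x
    ... | yes refl = trans (cong hue (≔-same {xs = row} x)) (cong hue (sym tok))
    ... | no y≢x   = cong hue (≔-other {xs = row} y≢x)

    module _ {m} (μ : Grid m n) {z : Fin m} (empty : μ z x ≡ nothing) where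

      potential-exit : potential (row [ x ≔ used ℓ ]) (mark μ z x ℓ) ≡ potential row μ
      potential-exit = sum-cong-≗ at where
        at : ∀ y → Φ ((row [ x ≔ used ℓ ]) y) (height (mark μ z x ℓ) y) ≡ Φ (row y) (height μ y)
        at y with y ≟ x
        ... | yes refl rewrite ≔-same {xs = row} {v = used ℓ} x | tok | height-mark {μ = μ} {ℓ = ℓ} empty = refl
        ... | no y≢x = cong₂ Φ (≔-other {xs = row} y≢x) (height-mark-other {μ = μ} y≢x)

      exit : Evacuation (row [ x ≔ used ℓ ]) (mark μ z x ℓ) → Evacuation row μ
      exit E = record
        { colours  = colours
        ; marks    = marks
        ; coloured = λ y ℓ′ eq → coloured y ℓ′ (trans (hue-used y) eq)
        ; extends  = extends′
        ; counts   = λ g → begin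
            count g marks                       ≡⟨ counts g ⟩
            count g (mark μ z x ℓ) + sum (load g ∘ row [ x ≔ used ℓ ])
              ≡⟨ cong (_+ sum (load g ∘ row [ x ≔ used ℓ ])) (count-mark {μ = μ} empty g) ⟩
            count g μ + g ℓ + sum (load g ∘ row [ x ≔ used ℓ ]) ≡⟨ ℕ.+-assoc (count g μ) (g ℓ) _ ⟩
            count g μ + (g ℓ + sum (load g ∘ row [ x ≔ used ℓ ])) ≡⟨ cong (count g μ +_) (load-used g) ⟩
            count g μ + sum (load g ∘ row) ∎
        ; exits    = exits′
        ; gains    = gains′
        }
        where
        open Evacuation E
        open ≡-Reasoning
        extends′ : Extends marks μ
        extends′ = Extends-trans extends (mark-extends {μ = μ} empty)
        marks-zx : marks z x ≡ just ℓ
        marks-zx = extends z x ℓ (mark-same {μ = μ})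
        exits′ : ∀ {y ℓ′} → row y ≡ token ℓ′ → ∃[ y ] ∃[ z ] colours y ≡ just ℓ′ × marks z y ≡ just ℓ′
        exits′ {y} eq with y ≟ x
        ... | no y≢x = exits (trans (≔-other {xs = row} y≢x) eq)
        ... | yes refl with refl ← trans (sym tok) eq =
          x , z , coloured x ℓ (cong hue (≔-same {xs = row} x)) , marks-zx
        gains′ : ∀ {y ℓ′} → row y ≡ token ℓ′ →
          (∃[ z ] μ z y ≡ nothing × Marked (marks z y)) ⊎ (∀ z → Marked (marks z y))
        gains′ {y} eq with y ≟ x
        ... | yes refl = inj₁ (z , empty , ℓ , marks-zx)
        ... | no y≢x with gains (trans (≔-other {xs = row} y≢x) eq)
        ...   | inj₁ (z′ , eq′ , mk) = inj₁ (z′ , Extends-nothing (mark-extends {μ = μ} empty) z′ y eq′ , mk)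
        ...   | inj₂ full = inj₂ full

    module _ {y : Fin n} (empty : row y ≡ free) where

      private
        moved : Fin n → State
        moved = row [ x ≔ used ℓ ] [ y ≔ token ℓ ]

        y≢x : y ≢ x
        y≢x refl with () ← trans (sym tok) empty

        used-y : (row [ x ≔ used ℓ ]) y ≡ free
        used-y = trans (≔-other {xs = row} y≢x) empty

      -- Only columns `x` and `y` change, so equality of the sums reduces to `balance`. The load,
      -- which ignores the column, and the potential, which depends on its height, are both
      -- instances.
      sum-move : (f : State → Fin n → ℕ) → f (used ℓ) x + f (token ℓ) y ≡ f (token ℓ) x + f free y →
        sum (λ i → f (moved i) i) ≡ sum (λ i → f (row i) i)
      sum-move f balance = ℕ.+-cancelʳ-≡ (f (token ℓ) x + f free y) _ _ (begin
        S₂ + (f (token ℓ) x + f free y)   ≡⟨ cong (S₂ +_) (ℕ.+-comm _ (f free y)) ⟩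
        S₂ + (f free y + f (token ℓ) x)   ≡⟨ ℕ.+-assoc S₂ _ _ ⟨
        S₂ + f free y + f (token ℓ) x     ≡⟨ cong (_+ f (token ℓ) x) step₂ ⟩
        S₁ + f (token ℓ) y + f (token ℓ) x ≡⟨ ℕ.+-assoc S₁ _ _ ⟩
        S₁ + (f (token ℓ) y + f (token ℓ) x) ≡⟨ cong (S₁ +_) (ℕ.+-comm (f (token ℓ) y) _) ⟩
        S₁ + (f (token ℓ) x + f (token ℓ) y) ≡⟨ ℕ.+-assoc S₁ _ _ ⟨
        S₁ + f (token ℓ) x + f (token ℓ) y ≡⟨ cong (_+ f (token ℓ) y) step₁ ⟩
        S₀ + f (used ℓ) x + f (token ℓ) y ≡⟨ ℕ.+-assoc S₀ _ _ ⟩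
        S₀ + (f (used ℓ) x + f (token ℓ) y) ≡⟨ cong (S₀ +_) balance ⟩
        S₀ + (f (token ℓ) x + f free y)   ∎)
        where
        open ≡-Reasoning
        S₀ S₁ S₂ : ℕ
        S₀ = sum (λ i → f (row i) i)
        S₁ = sum (λ i → f ((row [ x ≔ used ℓ ]) i) i)
        S₂ = sum (λ i → f (moved i) i)
        step₁ : S₁ + f (token ℓ) x ≡ S₀ + f (used ℓ) x
        step₁ = subst₂ (λ s t → S₁ + f s x ≡ S₀ + f t x) tok (≔-same {xs = row} x)
          (sum-replace x (λ i i≢x → cong (λ s → f s i) (≔-other {xs = row} i≢x)))
        step₂ : S₂ + f free y ≡ S₁ + f (token ℓ) y
        step₂ = subst₂ (λ s t → S₂ + f s y ≡ S₁ + f t y) used-y (≔-same {xs = row [ x ≔ used ℓ ]} y)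
          (sum-replace y (λ i i≢y → cong (λ s → f s i) (≔-other {xs = row [ x ≔ used ℓ ]} i≢y)))

      load-move : ∀ g → sum (load g ∘ moved) ≡ sum (load g ∘ row)
      load-move g = sum-move (λ s _ → load g s) (ℕ.+-comm 0 (g ℓ))

      move : ∀ {m} {μ : Grid m n} → (∀ z → Marked (μ z x)) → Evacuation moved μ → Evacuation row μ
      move {μ = μ} full E = record
        { colours  = colours
        ; marks    = marks
        ; coloured = λ i ℓ′ eq → coloured i ℓ′ (hue-moved i ℓ′ eq)
        ; extends  = extends
        ; counts   = λ g → trans (counts g) (cong (count g μ +_) (load-move g))
        ; exits    = exits′
        ; gains    = gains′
        }
        where
        open Evacuation E
        moved-y : moved y ≡ token ℓ
        moved-y = ≔-same {xs = row [ x ≔ used ℓ ]} y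
        moved-other : ∀ {i} → i ≢ x → i ≢ y → moved i ≡ row i
        moved-other i≢x i≢y = trans (≔-other {xs = row [ x ≔ used ℓ ]} i≢y) (≔-other {xs = row} i≢x)
        hue-moved : ∀ i ℓ′ → hue (row i) ≡ just ℓ′ → hue (moved i) ≡ just ℓ′
        hue-moved i ℓ′ eq with i ≟ y
        ... | yes refl with () ← trans (sym eq) (cong hue empty)
        ... | no i≢y = trans (cong hue (≔-other {xs = row [ x ≔ used ℓ ]} i≢y)) (trans (hue-used i) eq)
        token≢y : ∀ {i ℓ′} → row i ≡ token ℓ′ → i ≢ y
        token≢y eq refl with () ← trans (sym eq) empty
        exits′ : ∀ {i ℓ′} → row i ≡ token ℓ′ → ∃[ y ] ∃[ z ] colours y ≡ just ℓ′ × marks z y ≡ just ℓ′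
        exits′ {i} eq with i ≟ x
        ... | no i≢x = exits (trans (moved-other i≢x (token≢y eq)) eq)
        ... | yes refl with refl ← trans (sym tok) eq = exits moved-y
        gains′ : ∀ {i ℓ′} → row i ≡ token ℓ′ →
          (∃[ z ] μ z i ≡ nothing × Marked (marks z i)) ⊎ (∀ z → Marked (marks z i))
        gains′ {i} eq with i ≟ x
        ... | yes refl = inj₂ λ z → Extends-marked extends z x (full z)
        ... | no i≢x = gains (trans (moved-other i≢x (token≢y eq)) eq)

  -- Evacuation of a row

  Φ≡0 : ∀ {s w} → Φ s w ≡ 0 → s ≡ free × w ≡ 0
  Φ≡0 {free}    {w} eq = refl , eq
  Φ≡0 {used _}  {zero} ()
  Φ≡0 {used _}  {suc w} ()

  weight≡0 : ∀ {a} → weight one a ≡ 0 → a ≡ nothing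
  weight≡0 {nothing} eq = refl

  weight-marked : ∀ {a} → Marked a → weight one a ≡ 1
  weight-marked (ℓ , refl) = refl

  height-full : ∀ {m n} (μ : Grid m n) x → (∀ z → Marked (μ z x)) → height μ x ≡ m
  height-full {m} μ x full = trans (sum-const 1 (λ z → weight-marked (full z))) (ℕ.*-identityʳ m)

  token? : (s : State) → (∃ λ ℓ → s ≡ token ℓ) ⊎ (∀ ℓ → s ≢ token ℓ)
  token? free      = inj₂ λ _ ()
  token? (used ℓ)  = inj₂ λ _ ()
  token? (token ℓ) = inj₁ (ℓ , refl)

  load≡0 : ∀ g {s} → (∀ ℓ → s ≢ token ℓ) → load g s ≡ 0
  load≡0 g {free}    none = refl
  load≡0 g {used ℓ}  none = refl
  load≡0 g {token ℓ} none = contradiction refl (none ℓ)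

  zero? : ∀ k → k ≡ 0 ⊎ 1 ≤ k
  zero? zero    = inj₁ refl
  zero? (suc k) = inj₂ (s≤s z≤n)

  evacuate : ∀ k {m n} (row : Fin n → State) (μ : Grid (suc m) n) →
    sum (load one ∘ row) ≡ k → potential row μ < n + suc m → Evacuation row μ
  evacuate k {m} {n} row μ tokens bound with search (token? ∘ row)
  ... | inj₂ none = record
    { colours  = hue ∘ row
    ; marks    = μ
    ; coloured = λ x ℓ eq → eq
    ; extends  = λ r c ℓ eq → eq
    ; counts   = λ g → sym (trans (cong (count g μ +_)
        (trans (sum-const 0 (load≡0 g ∘ none)) (ℕ.*-zeroʳ n))) (ℕ.+-identityʳ _))
    ; exits    = λ {x} eq → contradiction eq (none x _)
    ; gains    = λ {x} eq → contradiction eq (none x _)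
    }
  evacuate zero row μ tokens bound | inj₁ (x , ℓ , tok)
    with () ← trans (load-used row tok one) tokens
  evacuate (suc k) {m} {n} row μ tokens bound | inj₁ (x , ℓ , tok) with search (λ z → marked? (μ z x))
  ... | inj₁ (z , empty) = exit row tok μ empty (evacuate k _ _
          (ℕ.suc-injective (trans (load-used row tok one) tokens))
          (subst (_< n + suc m) (sym (potential-exit row tok μ empty)) bound))
  ... | inj₂ full with search (λ y → zero? (Φ (row y) (height μ y)))
  -- The full column with its token contributes `suc (suc m)` and each of the other n - 1 columns at
  -- least one, which already amounts to `n + suc m`.
  ...   | inj₂ positive = contradiction bound (ℕ.<⇒≱ (s≤s (begin
            n + suc m                                    ≡⟨ ℕ.+-comm n (suc m) ⟩
            suc m + n                                    ≡⟨ cong (_+ n) (height-full μ x full) ⟨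
            height μ x + n                               ≤⟨ ℕ.≤-pred
              (subst (λ s → Φ s (height μ x) + n ≤ suc (potential row μ)) tok
                                                              (term+size≤sum positive x)) ⟩
            potential row μ                              ∎)))
          where open ℕ.≤-Reasoning
  ...   | inj₁ (y , Φ≡0y) with Φ≡0 {row y} Φ≡0y
  -- A move keeps the number of tokens, so it is followed at once by an exit to make `k` decrease.
  -- Column `y` has no mark at all, and row `zero` is as good as any other.
  ...     | empty , flat = move row tok empty full (exit moved moved-y μ bottom (evacuate k _ _
            (ℕ.suc-injective (trans (load-used moved moved-y one) (trans (load-move row tok empty one) tokens)))
            (subst (_< n + suc m) (sym (trans (potential-exit moved moved-y μ bottom) potential-move)) bound)))
          where
          moved : Fin n → State
          moved = row [ x ≔ used ℓ ] [ y ≔ token ℓ ]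
          moved-y : moved y ≡ token ℓ
          moved-y = ≔-same {xs = row [ x ≔ used ℓ ]} y
          bottom : μ zero y ≡ nothing
          bottom = weight≡0 (ℕ.n≤0⇒n≡0 (subst (weight one (μ zero y) ≤_) flat (term≤sum (λ z → weight one (μ z y)) zero)))
          potential-move : potential moved μ ≡ potential row μ
          potential-move = sum-move row tok empty (λ s i → Φ s (height μ i)) balance where
            balance : 1 ⊔ⁿ height μ x + suc (height μ y) ≡ suc (height μ x) + height μ y
            balance rewrite height-full μ x full = ℕ.+-suc (suc m) (height μ y)

  -- Joining equal marks inside colour classes

  Cell : ℕ → ℕ → Set
  Cell m n = Fin m × Fin n

  at : ∀ {m n} → Grid m n → Cell m n → Maybe L
  at μ (r , c) = μ r c

  Line : ∀ {m n} → Cell m n → Cell m n → Set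
  Line (r , c) (r′ , c′) = r ≡ r′ ⊎ c ≡ c′

  Link : ∀ {m n} → Grid m n → L → Cell m n → Cell m n → Set
  Link χ ℓ u v = Line u v × at χ u ≡ just ℓ × at χ v ≡ just ℓ

  Link-sym : ∀ {m n} {χ : Grid m n} {ℓ u v} → Link χ ℓ u v → Link χ ℓ v u
  Link-sym (inj₁ e , p , q) = inj₁ (sym e) , q , p
  Link-sym (inj₂ e , p , q) = inj₂ (sym e) , q , p

  record Knit {m n} (μ : Grid m n) : Set where
    field
      χ       : Grid m n
      extends : Extends χ μ
      joined  : ∀ {ℓ u v} → at μ u ≡ just ℓ → at μ v ≡ just ℓ → Star (Link χ ℓ) u v

  knit-transpose : ∀ {m n} {μ : Grid m n} → Knit (flip μ) → Knit μ
  knit-transpose K = record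
    { χ       = flip χ
    ; extends = λ r c → extends c r
    ; joined  = λ p q → gmap (λ (c , r) → r , c)
        (λ { (inj₁ e , p , q) → inj₂ e , p , q ; (inj₂ e , p , q) → inj₁ e , p , q }) (joined p q)
    } where open Knit K

  knit-row : ∀ {n} (μ : Grid 1 n) → Knit μ
  knit-row μ = record
    { χ       = μ
    ; extends = λ r c ℓ eq → eq
    ; joined  = λ { {u = zero , _} {v = zero , _} p q → return (inj₁ refl , p , q) }
    }

  -- Equal marks in row `r` are joined directly and those in the other rows by `K`. For one of each
  -- kind, `reach` gives a column in which to leave the row; it arrives at a mark of `ν`, possibly
  -- one handed down, and `K` joins this to the old mark.
  stitch : ∀ {m n} (μ : Grid (suc m) n) r {row : Fin n → Maybe L} {ν : Grid m n} → Knit ν →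
    (∀ x ℓ → μ r x ≡ just ℓ → row x ≡ just ℓ) → Extends ν (μ ∘ punchIn r) →
    (∀ {x ℓ z y} → μ r x ≡ just ℓ → μ (punchIn r z) y ≡ just ℓ →
      ∃[ y ] ∃[ z ] row y ≡ just ℓ × ν z y ≡ just ℓ) →
    Knit μ
  stitch {m} {n} μ r {row} {ν} K row-ext ν-ext reach = record
    { χ = ψ ; extends = ψ-ext ; joined = λ {ℓ} {u} {v} → ψ-joined {ℓ} {u} {v} }
    where
    open Knit K
    ψ : Grid (suc m) n
    ψ = insertAt χ r row
    ψ-row : ∀ x → ψ r x ≡ row x
    ψ-row x = cong (λ f → f x) (insertAt-lookup χ r row)
    ψ-rest : ∀ z x → ψ (punchIn r z) x ≡ χ z x
    ψ-rest z x = cong (λ f → f x) (insertAt-punchIn χ r row z)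
    ψ-ext : Extends ψ μ
    ψ-ext r′ x ℓ eq with punchIn-view r r′
    ... | inj₁ refl       = trans (ψ-row x) (row-ext x ℓ eq)
    ... | inj₂ (z , refl) = trans (ψ-rest z x) (extends z x ℓ (ν-ext z x ℓ eq))
    lift : ∀ {ℓ u v} → Star (Link χ ℓ) u v →
      Star (Link ψ ℓ) (punchIn r (proj₁ u) , proj₂ u) (punchIn r (proj₁ v) , proj₂ v)
    lift = gmap (λ (z , x) → punchIn r z , x) λ
      { (inj₁ e , p , q) → inj₁ (cong (punchIn r) e) , trans (ψ-rest _ _) p , trans (ψ-rest _ _) q
      ; (inj₂ e , p , q) → inj₂ e , trans (ψ-rest _ _) p , trans (ψ-rest _ _) q }
    descend : ∀ {ℓ x z y} → μ r x ≡ just ℓ → μ (punchIn r z) y ≡ just ℓ → Star (Link ψ ℓ) (r , x) (punchIn r z , y)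
    descend {ℓ} {x} {z} {y} p q with reach p q
    ... | y′ , z′ , row-y′ , ν-y′ =
      (inj₁ refl , ψ-ext r x ℓ p , trans (ψ-row y′) row-y′) ◅
      (inj₂ refl , trans (ψ-row y′) row-y′ , trans (ψ-rest z′ y′) (extends z′ y′ ℓ ν-y′)) ◅
      lift (joined ν-y′ (ν-ext z y ℓ q))
    ψ-joined : ∀ {ℓ u v} → at μ u ≡ just ℓ → at μ v ≡ just ℓ → Star (Link ψ ℓ) u v
    ψ-joined {ℓ} {r₁ , x} {r₂ , y} p q with punchIn-view r r₁ | punchIn-view r r₂
    ... | inj₁ refl       | inj₁ refl       = return (inj₁ refl , ψ-ext r x ℓ p , ψ-ext r y ℓ q)
    ... | inj₁ refl       | inj₂ (z , refl) = descend p q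
    ... | inj₂ (z , refl) | inj₁ refl       = reverse Link-sym (descend q p)
    ... | inj₂ (z , refl) | inj₂ (w , refl) = lift (joined (ν-ext z x ℓ p) (ν-ext w y ℓ q))

  -- Clearing a row while one label is joined along it

  count-row : ∀ {m n} (μ : Grid (suc m) n) r g → count g μ ≡ sum (weight g ∘ μ r) + count g (μ ∘ punchIn r)
  count-row μ r g = sum-remove {i = r} (λ z → sum (weight g ∘ μ z))

  weight≤count : ∀ {m n} (μ : Grid m n) z x g → weight g (μ z x) ≤ count g μ
  weight≤count μ z x g = ℕ.≤-trans (term≤sum (weight g ∘ μ z) x) (term≤sum (λ z → sum (weight g ∘ μ z)) z)

  height-positive : ∀ {m n} (μ : Grid m n) z x → Marked (μ z x) → 1 ≤ height μ x
  height-positive μ z x mk = subst (_≤ height μ x) (weight-marked mk) (term≤sum (λ z → weight one (μ z x)) z)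

  status : Maybe L → State
  status = maybe′ token free

  -- The label ℓ is not handed down from c₁ and c₂: these cells join its marks along the row.
  clear : ∀ {n} → (Fin n → Maybe L) → Fin n → Fin n → L → Fin n → State
  clear R c₁ c₂ ℓ x with x ≟ c₁ | x ≟ c₂
  ... | yes _ | _     = used ℓ
  ... | no _  | yes _ = used ℓ
  ... | no _  | no _  = status (R x)

  clear-view : ∀ {n} (R : Fin n → Maybe L) c₁ c₂ ℓ x →
    ((x ≡ c₁ ⊎ x ≡ c₂) × clear R c₁ c₂ ℓ x ≡ used ℓ) ⊎ (x ≢ c₁ × x ≢ c₂ × clear R c₁ c₂ ℓ x ≡ status (R x))
  clear-view R c₁ c₂ ℓ x with x ≟ c₁ | x ≟ c₂
  ... | yes x≡c₁ | _        = inj₁ (inj₁ x≡c₁ , refl)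
  ... | no _     | yes x≡c₂ = inj₁ (inj₂ x≡c₂ , refl)
  ... | no x≢c₁  | no x≢c₂  = inj₂ (x≢c₁ , x≢c₂ , refl)

  clear-hit : ∀ {n} (R : Fin n → Maybe L) c₁ c₂ ℓ x → x ≡ c₁ ⊎ x ≡ c₂ → clear R c₁ c₂ ℓ x ≡ used ℓ
  clear-hit R c₁ c₂ ℓ x hit with clear-view R c₁ c₂ ℓ x
  ... | inj₁ (_ , eq)            = eq
  ... | inj₂ (x≢c₁ , x≢c₂ , _) = [ ⊥-elim ∘ x≢c₁ , ⊥-elim ∘ x≢c₂ ]′ hit

  clear-miss : ∀ {n} (R : Fin n → Maybe L) {c₁ c₂} ℓ {x ℓ′} → x ≢ c₁ → x ≢ c₂ → R x ≡ just ℓ′ →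
    clear R c₁ c₂ ℓ x ≡ token ℓ′
  clear-miss R {c₁} {c₂} ℓ {x} x≢c₁ x≢c₂ eq with clear-view R c₁ c₂ ℓ x
  ... | inj₁ (hit , _)    = [ ⊥-elim ∘ x≢c₁ , ⊥-elim ∘ x≢c₂ ]′ hit
  ... | inj₂ (_ , _ , eq′) = trans eq′ (cong status eq)

  -- The mark at `c₁` is the one to be saved, and `c₂`, which may equal `c₁`, is the column in which
  -- its label leaves the row. A used cell has potential at least one: at `c₁` the mark itself pays
  -- for it, at `c₂` this is the purpose of `support`.
  module Clearing {m n} (R : Fin n → Maybe L) (O : Grid (suc m) n) (c₁ c₂ : Fin n) (ℓ : L)
    (R-c₁ : R c₁ ≡ just ℓ) (R-c₂ : ∀ {ℓ′} → R c₂ ≡ just ℓ′ → ℓ′ ≡ ℓ)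
    (support : 1 ≤ weight one (R c₂) + height O c₂) where

    row : Fin n → State
    row = clear R c₁ c₂ ℓ

    hit-label : ∀ {x ℓ′} → x ≡ c₁ ⊎ x ≡ c₂ → R x ≡ just ℓ′ → ℓ′ ≡ ℓ
    hit-label (inj₁ refl) eq = just-injective (trans (sym eq) R-c₁)
    hit-label (inj₂ refl) eq = R-c₂ eq

    hue-row : ∀ x ℓ′ → R x ≡ just ℓ′ → hue (row x) ≡ just ℓ′
    hue-row x ℓ′ eq with clear-view R c₁ c₂ ℓ x
    ... | inj₁ (hit , eq′)   = trans (cong hue eq′) (cong just (sym (hit-label hit eq)))
    ... | inj₂ (_ , _ , eq′) = trans (cong hue eq′) (cong (hue ∘ status) eq)

    Φ≤ : ∀ x → Φ (row x) (height O x) ≤ weight one (R x) + height O x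
    Φ≤ x with clear-view R c₁ c₂ ℓ x
    ... | inj₁ (hit , eq) rewrite eq = ℕ.⊔-lub (supported hit) (ℕ.m≤n+m (height O x) (weight one (R x)))
      where
      supported : x ≡ c₁ ⊎ x ≡ c₂ → 1 ≤ weight one (R x) + height O x
      supported (inj₁ refl) rewrite R-c₁ = s≤s z≤n
      supported (inj₂ refl) = support
    ... | inj₂ (_ , _ , eq) rewrite eq with R x
    ...   | nothing = ℕ.≤-refl
    ...   | just _  = ℕ.≤-refl

    -- A used cell above a nonempty column adds nothing to the height, as `1 ⊔ⁿ h` is `h` for
    -- positive `h`. The weight of its own mark is gained.
    Φ< : ∀ x → x ≡ c₁ ⊎ x ≡ c₂ → Marked (R x) → 1 ≤ height O x →
      Φ (row x) (height O x) < weight one (R x) + height O x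
    Φ< x hit (_ , eq) 1≤h rewrite clear-hit R c₁ c₂ ℓ x hit | eq = s≤s (ℕ.⊔-lub 1≤h ℕ.≤-refl)

    sum-bounds : sum (λ x → weight one (R x) + height O x) ≡ sum (weight one ∘ R) + count one O
    sum-bounds = trans (∑-distrib-+ (weight one ∘ R) (height O))
      (cong (sum (weight one ∘ R) +_) (sym (∑-comm (λ z x → weight one (O z x)))))

    potential≤ : potential row O ≤ sum (weight one ∘ R) + count one O
    potential≤ = ℕ.≤-trans (sum-mono Φ≤) (ℕ.≤-reflexive sum-bounds)

    potential< : ∀ x → x ≡ c₁ ⊎ x ≡ c₂ → Marked (R x) → 1 ≤ height O x →
      potential row O < sum (weight one ∘ R) + count one O
    potential< x hit mk 1≤h = ℕ.≤-trans (sum-mono-+ 1 Φ≤ x (Φ< x hit mk 1≤h)) (ℕ.≤-reflexive sum-bounds)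

    load≤ : ∀ g x → load g (row x) ≤ weight g (R x)
    load≤ g x with clear-view R c₁ c₂ ℓ x
    ... | inj₁ (_ , eq) rewrite eq = z≤n
    ... | inj₂ (_ , _ , eq) rewrite eq with R x
    ...   | nothing = ℕ.≤-refl
    ...   | just _  = ℕ.≤-refl

    load-gap : ∀ g {x} → x ≡ c₁ ⊎ x ≡ c₂ → R x ≡ just ℓ → g ℓ + load g (row x) ≤ weight g (R x)
    load-gap g {x} hit eq rewrite clear-hit R c₁ c₂ ℓ x hit | eq = ℕ.≤-reflexive (ℕ.+-identityʳ (g ℓ))

    evacuation : potential row O < n + suc m → Evacuation row O
    evacuation = evacuate _ row O refl

    module _ (E : Evacuation row O) where
      open Evacuation E

      counts≤ : ∀ g → count g marks + g ℓ ≤ sum (weight g ∘ R) + count g O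
      counts≤ g = begin
        count g marks + g ℓ                       ≡⟨ cong (_+ g ℓ) (counts g) ⟩
        count g O + sum (load g ∘ row) + g ℓ      ≡⟨ ℕ.+-assoc (count g O) _ _ ⟩
        count g O + (sum (load g ∘ row) + g ℓ)    ≡⟨ cong (count g O +_) (ℕ.+-comm _ (g ℓ)) ⟩
        count g O + (g ℓ + sum (load g ∘ row))    ≤⟨ ℕ.+-monoʳ-≤ (count g O)
          (sum-mono-+ (g ℓ) (load≤ g) c₁ (load-gap g (inj₁ refl) R-c₁)) ⟩
        count g O + sum (weight g ∘ R)            ≡⟨ ℕ.+-comm (count g O) _ ⟩
        sum (weight g ∘ R) + count g O            ∎
        where open ℕ.≤-Reasoning

      counts≤₂ : c₁ ≢ c₂ → R c₂ ≡ just ℓ → 2 + count one marks ≤ sum (weight one ∘ R) + count one O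
      counts≤₂ c₁≢c₂ eq = begin
        2 + count one marks                         ≡⟨ cong (2 +_) (counts one) ⟩
        2 + (count one O + sum (load one ∘ row))    ≡⟨ cong (2 +_) (ℕ.+-comm (count one O) _) ⟩
        2 + sum (load one ∘ row) + count one O      ≤⟨ ℕ.+-monoˡ-≤ (count one O) (sum-mono-<₂ (load≤ one) c₁≢c₂
                                                         (load-gap one (inj₁ refl) R-c₁) (load-gap one (inj₂ refl) eq)) ⟩
        sum (weight one ∘ R) + count one O          ∎
        where open ℕ.≤-Reasoning

      -- Tokens cross to the other rows by their exits. The label `ℓ` crosses in column `c₂`, where
      -- `hook` finds it as soon as it occurs in another row.
      restore : (μ : Grid (suc (suc m)) n) (r : Fin (suc (suc m))) → μ r ≡ R → Extends O (μ ∘ punchIn r) →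
        (∀ {z x} → μ (punchIn r z) x ≡ just ℓ → ∃[ z ] O z c₂ ≡ just ℓ) → Knit marks → Knit μ
      restore μ r refl O-ext hook K = stitch μ r K
        (λ x ℓ′ eq → coloured x ℓ′ (hue-row x ℓ′ eq)) (Extends-trans extends O-ext) reach
        where
        reach : ∀ {x ℓ′ z y} → R x ≡ just ℓ′ → μ (punchIn r z) y ≡ just ℓ′ →
          ∃[ y ] ∃[ z ] colours y ≡ just ℓ′ × marks z y ≡ just ℓ′
        reach {x} p q with clear-view R c₁ c₂ ℓ x
        ... | inj₂ (x≢c₁ , x≢c₂ , _) = exits {x} (clear-miss R ℓ x≢c₁ x≢c₂ p)
        ... | inj₁ (hit , eq) with refl ← hit-label hit p with z , O-zc₂ ← hook q =
          c₂ , z , coloured c₂ ℓ (cong hue (clear-hit R c₁ c₂ ℓ c₂ (inj₂ refl))) , extends z c₂ ℓ O-zc₂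

  -- Sparse markings and the deletion of one line

  δ : L → L → ℕ
  δ ℓ ℓ′ with ℓ ≟ᴸ ℓ′
  ... | yes _ = 1
  ... | no _  = 0

  δ-same : ∀ ℓ → δ ℓ ℓ ≡ 1
  δ-same ℓ with ℓ ≟ᴸ ℓ
  ... | yes _  = refl
  ... | no ℓ≢ℓ = contradiction refl ℓ≢ℓ

  -- With `d₁ + 1` rows and `d₂ + 1` columns this allows exactly `d₁ + d₂` marks, enough for the
  -- terminals of ⌊(d₁ + d₂) / 2⌋ pairs.
  Sparse : ∀ {m n} → Grid m n → Set
  Sparse {m} {n} μ = 2 + count one μ ≤ m + n

  Paired : ∀ {m n} → Grid m n → Set
  Paired μ = ∀ ℓ → count (δ ℓ) μ ≤ 2

  Knits : ℕ → ℕ → Set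
  Knits m n = (μ : Grid m n) → Sparse μ → Paired μ → Knit μ

  count-flip : ∀ {m n} (μ : Grid m n) g → count g (flip μ) ≡ count g μ
  count-flip μ g = ∑-comm (λ c r → weight g (μ r c))

  sparse-flip : ∀ {m n} (μ : Grid m n) → Sparse μ → Sparse (flip μ)
  sparse-flip {m} {n} μ sp = subst₂ _≤_ (cong (2 +_) (sym (count-flip μ one))) (ℕ.+-comm m n) sp

  paired-flip : ∀ {m n} (μ : Grid m n) → Paired μ → Paired (flip μ)
  paired-flip μ pd ℓ = subst (_≤ 2) (sym (count-flip μ (δ ℓ))) (pd ℓ)

  knits-flip : ∀ {m n} → Knits m n → Knits n m
  knits-flip K μ sp pd = knit-transpose (K (flip μ) (sparse-flip μ sp) (paired-flip μ pd))

  -- The obstruction to joining the mark at (r , c) to an equal one through row r.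
  Cornered : ∀ {m n} → Grid (suc m) n → Fin (suc m) → Fin n → L → Set
  Cornered μ r c ℓ = ∃[ z ] ∃[ c′ ] c′ ≢ c × μ (punchIn r z) c′ ≡ just ℓ × Marked (μ r c′)

  AllCornered : ∀ {m n} → Grid (suc m) n → Set
  AllCornered μ = ∀ r c ℓ → μ r c ≡ just ℓ → Cornered μ r c ℓ

  label? : ∀ ℓ a → a ≡ just ℓ ⊎ a ≢ just ℓ
  label? ℓ nothing = inj₂ λ ()
  label? ℓ (just ℓ′) with ℓ′ ≟ᴸ ℓ
  ... | yes refl = inj₁ refl
  ... | no ℓ′≢ℓ  = inj₂ λ { refl → ℓ′≢ℓ refl }

  module _ {m n} (K : Knits (suc m) n) (μ : Grid (suc (suc m)) n) (sp : Sparse μ) (pd : Paired μ)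
    (r : Fin (suc (suc m))) (c : Fin n) (ℓ : L) (μrc : μ r c ≡ just ℓ) where

    private
      O : Grid (suc m) n
      O = μ ∘ punchIn r

    -- The mark at (`r` , `c`) is not handed down: it reaches an equal mark along row `r` and then
    -- down column `c′`. One mark fewer makes up for one row fewer in `Sparse`.
    knit-by-deletion : ∀ c′ → (∀ {ℓ′} → μ r c′ ≡ just ℓ′ → ℓ′ ≡ ℓ) → 1 ≤ weight one (μ r c′) + height O c′ →
      (∀ {z x} → O z x ≡ just ℓ → ∃[ z ] O z c′ ≡ just ℓ) → Knit μ
    knit-by-deletion c′ μrc′ support hook = restore E μ r refl (λ _ _ _ eq → eq) hook (K marks sparse paired)
      where
      open Clearing (μ r) O c c′ ℓ μrc μrc′ support
      E : Evacuation row O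
      E = evacuation (begin-strict
        potential row O                            ≤⟨ potential≤ ⟩
        sum (weight one ∘ μ r) + count one O       ≡⟨ count-row μ r one ⟨
        count one μ                                ≤⟨ ℕ.≤-pred (ℕ.≤-pred sp) ⟩
        m + n                                      <⟨ ℕ.n<1+n (m + n) ⟩
        suc m + n                                  ≡⟨ ℕ.+-comm (suc m) n ⟩
        n + suc m                                  ∎)
        where open ℕ.≤-Reasoning
      open Evacuation E
      counts′ : ∀ g → count g marks + g ℓ ≤ count g μ
      counts′ g = ℕ.≤-trans (counts≤ E g) (ℕ.≤-reflexive (sym (count-row μ r g)))
      sparse : Sparse marks
      sparse = ℕ.≤-pred (begin
        3 + count one marks     ≡⟨ cong (2 +_) (ℕ.+-comm 1 (count one marks)) ⟩
        2 + (count one marks + 1) ≤⟨ s≤s (s≤s (counts′ one)) ⟩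
        2 + count one μ         ≤⟨ sp ⟩
        suc (suc m) + n         ∎)
        where open ℕ.≤-Reasoning
      paired : Paired marks
      paired ℓ′ = ℕ.≤-trans (ℕ.m+n≤o⇒m≤o (count (δ ℓ′) marks) (counts′ (δ ℓ′))) (pd ℓ′)

    knit-or-cornered : Knit μ ⊎ Cornered μ r c ℓ
    knit-or-cornered with search (λ z → search (λ c′ → label? ℓ (O z c′)))
    -- No other row contains `ℓ`, so there is nothing to reach: `c` itself serves as `c′`, with a
    -- vacuous hook.
    ... | inj₂ alone = inj₁ (knit-by-deletion c (λ eq → just-injective (trans (sym eq) μrc))
            (ℕ.m≤n⇒m≤n+o _ (ℕ.≤-reflexive (sym (weight-marked (ℓ , μrc)))))
            (λ {z} {x} eq → contradiction eq (alone z x)))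
    ... | inj₁ (z , c′ , eq) with c′ ≟ c | marked? (μ r c′)
    ...   | no c′≢c  | inj₂ mk = inj₂ (z , c′ , c′≢c , eq , mk)
    ...   | yes refl | _ = inj₁ (knit-by-deletion c (λ eq → just-injective (trans (sym eq) μrc))
            (ℕ.m≤n⇒m≤n+o _ (ℕ.≤-reflexive (sym (weight-marked (ℓ , μrc))))) (λ _ → z , eq))
    -- The free cell (`r` , `c′`) is coloured `ℓ`, and the equal mark in column `c′` provides the
    -- support.
    ...   | no _     | inj₁ empty = inj₁ (knit-by-deletion c′
            (λ eq → contradiction (trans (sym empty) eq) λ ())
            (ℕ.m≤n⇒m≤o+n (weight one (μ r c′)) (height-positive O z c′ (ℓ , eq))) (λ _ → z , eq))

  knit-or-all-cornered : ∀ {m n} → Knits (suc m) n → (μ : Grid (suc (suc m)) n) → Sparse μ → Paired μ →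
    Knit μ ⊎ AllCornered μ
  knit-or-all-cornered K μ sp pd with search swapped where
    swapped : ∀ r → (∃ λ c → Knit μ) ⊎ (∀ c ℓ → μ r c ≡ just ℓ → Cornered μ r c ℓ)
    swapped r = search by-cell where
      by-cell : ∀ c → Knit μ ⊎ (∀ ℓ → μ r c ≡ just ℓ → Cornered μ r c ℓ)
      by-cell c with marked? (μ r c)
      ... | inj₁ empty = inj₂ λ ℓ eq → contradiction (trans (sym empty) eq) λ ()
      ... | inj₂ (ℓ , μrc) with knit-or-cornered K μ sp pd r c ℓ μrc
      ...   | inj₁ k = inj₁ k
      ...   | inj₂ cornered = inj₂ λ ℓ′ eq → subst (Cornered μ r c) (just-injective (trans (sym μrc) eq)) cornered
  ... | inj₁ (_ , _ , k) = inj₁ k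
  ... | inj₂ cornered    = inj₂ cornered

  -- Markings in which every mark is cornered

  two-in-row : ∀ {n} {g} (R : Fin n → Maybe L) {c c′} → c ≢ c′ → 1 ≤ weight g (R c) → 1 ≤ weight g (R c′) →
    2 ≤ sum (weight g ∘ R)
  two-in-row R c≢c′ p q = ℕ.≤-trans (ℕ.m≤m+n 2 _) (sum-mono-<₂ {f = const 0} (λ _ → z≤n) c≢c′ p q)

  marked-weight : ∀ {a} → Marked a → 1 ≤ weight one a
  marked-weight mk = ℕ.≤-reflexive (sym (weight-marked mk))

  rows-doubled : ∀ {m n} (μ : Grid (suc m) n) → AllCornered μ → (∀ r → ∃ λ c → Marked (μ r c)) →
    suc m + suc m ≤ count one μ
  rows-doubled {m} {n} μ cornered inhabited = begin
    suc m + suc m           ≡⟨ cong (suc m +_) (ℕ.+-identityʳ (suc m)) ⟨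
    2 * suc m               ≡⟨ ℕ.*-comm 2 (suc m) ⟩
    suc m * 2               ≡⟨ sum-const {f = λ (_ : Fin (suc m)) → 2} 2 (λ _ → refl) ⟨
    sum (λ (_ : Fin (suc m)) → 2) ≤⟨ sum-mono double ⟩
    count one μ             ∎
    where
    open ℕ.≤-Reasoning
    double : ∀ r → 2 ≤ sum (weight one ∘ μ r)
    double r with c , ℓ , μrc ← inhabited r with z , c′ , c′≢c , _ , mk ← cornered r c ℓ μrc =
      two-in-row (μ r) c′≢c (marked-weight mk) (marked-weight (ℓ , μrc))

  -- The marking may exceed `Sparse` by one, since two marks are dropped with one row; `Paired`
  -- excludes a third `ℓ` outside it. The last hypothesis takes a `Fin m` so that it is vacuous for
  -- a single row, where all cells are already collinear.
  knit-pair-in-row : ∀ {m n} → Knits m n → (ν : Grid (suc m) n) → Paired ν → count one ν ≤ m + n →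
    ∀ z {c₁ c₂ ℓ} → c₁ ≢ c₂ → ν z c₁ ≡ just ℓ → ν z c₂ ≡ just ℓ →
    (Fin m → ∃[ j ] Marked (ν (punchIn z j) c₂)) → Knit ν
  knit-pair-in-row {zero} K ν pd few z c₁≢c₂ p q crowded = knit-row ν
  knit-pair-in-row {suc m} {n} K ν pd few z {c₁} {c₂} {ℓ} c₁≢c₂ p q crowded =
    restore E ν z refl (λ _ _ _ eq → eq) (λ eq → contradiction (pd ℓ) (ℕ.<⇒≱ (third eq))) (K marks sparse paired)
    where
    O : Grid (suc m) n
    O = ν ∘ punchIn z
    open Clearing (ν z) O c₁ c₂ ℓ p (λ eq → just-injective (trans (sym eq) q))
      (ℕ.m≤n⇒m≤n+o _ (marked-weight (ℓ , q)))
    total : ∀ g → sum (weight g ∘ ν z) + count g O ≡ count g ν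
    total g = sym (count-row ν z g)
    E : Evacuation row O
    -- `few` alone bounds the potential only weakly; a mark of another row in column `c₂` makes the
    -- bound strict.
    E with j , mk ← crowded zero = evacuation (begin-strict
      potential row O                      <⟨ potential< c₂ (inj₂ refl) (ℓ , q) (height-positive O j c₂ mk) ⟩
      sum (weight one ∘ ν z) + count one O ≡⟨ total one ⟩
      count one ν                          ≤⟨ few ⟩
      suc m + n                            ≡⟨ ℕ.+-comm (suc m) n ⟩
      n + suc m                            ∎)
      where open ℕ.≤-Reasoning
    open Evacuation E
    third : ∀ {j x} → O j x ≡ just ℓ → 2 < count (δ ℓ) ν
    third {j} {x} eq = begin
      2 + 1                                    ≤⟨ ℕ.+-mono-≤ (two-in-row (ν z) c₁≢c₂ (marked-δ p) (marked-δ q))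
                                                    (ℕ.≤-trans (marked-δ eq) (weight≤count O j x (δ ℓ))) ⟩
      sum (weight (δ ℓ) ∘ ν z) + count (δ ℓ) O ≡⟨ total (δ ℓ) ⟩
      count (δ ℓ) ν                            ∎
      where
      open ℕ.≤-Reasoning
      marked-δ : ∀ {a} → a ≡ just ℓ → 1 ≤ weight (δ ℓ) a
      marked-δ refl = ℕ.≤-reflexive (sym (δ-same ℓ))
    sparse : Sparse marks
    sparse = ℕ.≤-trans (counts≤₂ E c₁≢c₂ q) (ℕ.≤-trans (ℕ.≤-reflexive (total one)) few)
    paired : Paired marks
    paired ℓ′ = ℕ.≤-trans (ℕ.m+n≤o⇒m≤o (count (δ ℓ′) marks) (counts≤ E (δ ℓ′)))
      (ℕ.≤-trans (ℕ.≤-reflexive (total (δ ℓ′))) (pd ℓ′))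

  module _ {m n} (K : Knits m n) (μ : Grid (suc (suc m)) n) (sp : Sparse μ) (pd : Paired μ)
    {r c c′ ℓ} {z : Fin (suc m)} (μrc : μ r c ≡ just ℓ) (c′≢c : c′ ≢ c) (μzc′ : μ (punchIn r z) c′ ≡ just ℓ)
    (μrc′ : Marked (μ r c′)) {k} (μkc : Marked (μ (punchIn r k) c))
    {C} (empty : ∀ r → μ r C ≡ nothing) where

    -- The pair at (r , c) and (r′ , c′), r′ = punchIn r z, is joined along row r, column C and row r′.
    -- Row r is deleted after adding the mark (r′ , C), and then row r′, whose marks C and c′ are
    -- dropped.  The other marks in columns c (row k) and c′ (row r) provide the slack in the potential.
    private
      column≢ : ∀ {r c} → Marked (μ r c) → c ≢ C
      column≢ {r} (ℓ , eq) refl with () ← trans (sym eq) (empty r)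

      rest O : Grid (suc m) n
      rest = μ ∘ punchIn r
      O = mark rest z C ℓ

      O-extends : Extends O rest
      O-extends = mark-extends {μ = rest} {z = z} {x = C} {ℓ = ℓ} (empty _)

      O-zC : O z C ≡ just ℓ
      O-zC = mark-same {μ = rest} {z} {C}

      module C₁ = Clearing (μ r) O c C ℓ μrc (λ eq → contradiction (trans (sym (empty r)) eq) λ ())
        (ℕ.m≤n⇒m≤o+n (weight one (μ r C)) (height-positive O z C (ℓ , O-zC)))

      total : ∀ g → sum (weight g ∘ μ r) + count g O ≡ count g μ + g ℓ
      total g = begin
        sum (weight g ∘ μ r) + count g O             ≡⟨ cong (sum (weight g ∘ μ r) +_)
          (count-mark {μ = rest} {z} {C} {ℓ} (empty _) g) ⟩
        sum (weight g ∘ μ r) + (count g rest + g ℓ)  ≡⟨ ℕ.+-assoc (sum (weight g ∘ μ r)) (count g rest) (g ℓ) ⟨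
        sum (weight g ∘ μ r) + count g rest + g ℓ    ≡⟨ cong (_+ g ℓ) (count-row μ r g) ⟨
        count g μ + g ℓ                              ∎
        where open ≡-Reasoning

      few : count one μ ≤ m + n
      few = ℕ.≤-pred (ℕ.≤-pred sp)

      E₁ : Evacuation C₁.row O
      E₁ = C₁.evacuation (begin-strict
        potential C₁.row O                    <⟨ C₁.potential< c (inj₁ refl) (ℓ , μrc)
                                                   (height-positive O k c (Extends-marked O-extends k c μkc)) ⟩
        sum (weight one ∘ μ r) + count one O  ≡⟨ total one ⟩
        count one μ + 1                       ≤⟨ ℕ.+-monoˡ-≤ 1 few ⟩
        m + n + 1                             ≡⟨ ℕ.+-comm (m + n) 1 ⟩
        suc m + n                             ≡⟨ ℕ.+-comm (suc m) n ⟩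
        n + suc m                             ∎)
        where open ℕ.≤-Reasoning

      module E₁ = Evacuation E₁

      -- The label added at (`z` , `C`) cancels against the one dropped at (`r` , `c`).
      counts₁ : ∀ g → count g E₁.marks ≤ count g μ
      counts₁ g = ℕ.+-cancelʳ-≤ (g ℓ) _ _ (ℕ.≤-trans (C₁.counts≤ E₁ g) (ℕ.≤-reflexive (total g)))

      O-zc′ : O z c′ ≡ just ℓ
      O-zc′ = O-extends z c′ ℓ μzc′

      -- The mark at (`r` , `c′`) was a token, so by `gains` it has filled a vacant cell of column
      -- `c′` or the column is full. The vacant cell is not in row `z`, where the column already
      -- carried `ℓ`.
      crowded : Fin m → ∃[ j ] Marked (E₁.marks (punchIn z j) c′)
      crowded i with E₁.gains (clear-miss (μ r) ℓ c′≢c (column≢ μrc′) (proj₂ μrc′))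
      ... | inj₂ full = i , full (punchIn z i)
      ... | inj₁ (w , vacant , mk) with punchIn-view z w
      ...   | inj₁ refl = contradiction (trans (sym vacant) O-zc′) λ ()
      ...   | inj₂ (j , refl) = j , mk

      knit₁ : Knit E₁.marks
      knit₁ = knit-pair-in-row K E₁.marks (λ ℓ′ → ℕ.≤-trans (counts₁ (δ ℓ′)) (pd ℓ′))
        (ℕ.≤-trans (counts₁ one) few) z (≢-sym (column≢ (ℓ , μzc′)))
        (E₁.extends z C ℓ O-zC) (E₁.extends z c′ ℓ O-zc′) crowded

    knit-by-empty-column : Knit μ
    knit-by-empty-column = C₁.restore E₁ μ r refl O-extends (λ _ → z , O-zC) knit₁

  knit-empty-column : ∀ {m n} → Knits m (suc n) → (μ : Grid (suc (suc m)) (suc n)) → Sparse μ → Paired μ →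
    AllCornered μ → AllCornered (flip μ) → ∀ {C} → (∀ r → μ r C ≡ nothing) → Knit μ
  knit-empty-column K μ sp pd rows columns empty with search (λ r → search (λ c → swap (marked? (μ r c))))
  ... | inj₂ none = record
    { χ       = μ
    ; extends = λ _ _ _ eq → eq
    ; joined  = λ {ℓ} {u} p → contradiction (trans (sym (none (proj₁ u) (proj₂ u))) p) λ ()
    }
  -- The corner along the row supplies the partner and the mark at (`r` , `c′`); the corner along
  -- the column supplies a second mark in column `c`.
  ... | inj₁ (r , c , ℓ , μrc) with rows r c ℓ μrc | columns c r ℓ μrc
  ...   | z , c′ , c′≢c , μzc′ , μrc′ | _ , r′ , r′≢r , _ , μr′c with punchIn-view r r′
  ...     | inj₁ r′≡r = contradiction r′≡r r′≢r
  ...     | inj₂ (k , refl) = knit-by-empty-column K μ sp pd μrc c′≢c μzc′ μrc′ μr′c empty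

  empty-line : ∀ {m n} (μ : Grid (suc m) (suc n)) → Sparse μ → AllCornered μ → AllCornered (flip μ) →
    (∃[ C ] (∀ r → μ r C ≡ nothing)) ⊎ (∃[ R ] (∀ c → μ R c ≡ nothing))
  empty-line {m} {n} μ sp rows columns
    with search (λ c → swap (search (λ r → swap (marked? (μ r c)))))
       | search (λ r → swap (search (λ c → swap (marked? (μ r c)))))
  ... | inj₁ C          | _      = inj₁ C
  ... | inj₂ _          | inj₁ R = inj₂ R
  ... | inj₂ inhabitedᶜ | inj₂ inhabitedʳ = contradiction sp (ℕ.<⇒≱ (s≤s (ℕ.m≤n⇒m≤1+n half)))
    where
    half : suc m + suc n ≤ count one μ
    half with ℕ.≤-total (suc m) (suc n)
    ... | inj₁ m≤n = ℕ.≤-trans (ℕ.+-monoˡ-≤ (suc n) m≤n)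
      (ℕ.≤-trans (rows-doubled (flip μ) columns inhabitedᶜ) (ℕ.≤-reflexive (count-flip μ one)))
    ... | inj₂ n≤m = ℕ.≤-trans (ℕ.+-monoʳ-≤ (suc m) n≤m) (rows-doubled μ rows inhabitedʳ)

  -- `K₁` and `K₂` serve the deletion of one row or one column, `K₃` and `K₄` that of two parallel
  -- lines.
  knits-step : ∀ {m n} → Knits (suc m) (2 + n) → Knits (2 + m) (suc n) → Knits m (2 + n) → Knits (2 + m) n →
    Knits (2 + m) (2 + n)
  knits-step K₁ K₂ K₃ K₄ μ sp pd =
    [ (λ K → K) , (λ rows →
    [ knit-transpose , (λ columns →
    [ (λ (_ , empty) → knit-empty-column K₃ μ sp pd rows columns empty)
    , (λ (_ , empty) → knit-transpose (knit-empty-column (knits-flip K₄) (flip μ) sp′ pd′ columns rows empty))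
    ]′ (empty-line μ sp rows columns))
    ]′ (knit-or-all-cornered (knits-flip K₂) (flip μ) sp′ pd′))
    ]′ (knit-or-all-cornered K₁ μ sp pd)
    where
    sp′ = sparse-flip μ sp
    pd′ = paired-flip μ pd

  knits : ∀ m n → Knits m n
  knits zero          n             μ sp pd = record { χ = μ ; extends = λ _ _ _ eq → eq ; joined = λ { {u = () , _} } }
  knits (suc zero)    n             μ sp pd = knit-row μ
  knits (suc (suc m)) zero          μ sp pd = record { χ = μ ; extends = λ _ _ _ eq → eq ; joined = λ { {u = _ , ()} } }
  knits (suc (suc m)) (suc zero)    μ sp pd = knit-transpose (knit-row (flip μ))
  knits (suc (suc m)) (suc (suc n)) =
    knits-step (knits (suc m) (suc (suc n))) (knits (suc (suc m)) (suc n))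
      (knits m (suc (suc n))) (knits (suc (suc m)) n)

-- Placing the terminals on the grid

module Placement (L : Set) (_≟ᴸ_ : DecidableEquality L) where
  open Knitting L _≟ᴸ_

  -- `only` is what keeps the next cell vacant in the induction of `place`, so that its mark adds
  -- exactly its weight to `total`.
  record Placed {m n N} (a : Fin N → Cell m n) (label : Fin N → L) : Set where
    field
      grid   : Grid m n
      placed : ∀ i → at grid (a i) ≡ just (label i)
      only   : ∀ u → Marked (at grid u) → ∃[ i ] a i ≡ u
      total  : ∀ g → count g grid ≡ sum (g ∘ label)

  place : ∀ {m n N} {a : Fin N → Cell m n} (label : Fin N → L) → Injective _≡_ _≡_ a → Placed a label
  place {m} {n} {zero} label inj = record
    { grid   = λ _ _ → nothing
    ; placed = λ ()
    ; only   = λ _ ()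
    ; total  = λ g → trans (sum-const {m} 0 (λ _ → trans (sum-const {n} 0 (λ _ → refl)) (ℕ.*-zeroʳ n))) (ℕ.*-zeroʳ m)
    }
  place {m} {n} {suc N} {a} label inj = record
    { grid   = mark grid z x ℓ
    ; placed = λ { zero → mark-same {μ = grid} ; (suc i) → mark-extends {μ = grid} vacant _ _ _ (placed i) }
    ; only   = λ { (z′ , x′) → only′ z′ x′ }
    ; total  = λ g → trans (count-mark {μ = grid} vacant g) (trans (ℕ.+-comm _ (g ℓ)) (cong (g ℓ +_) (total g)))
    }
    where
    open Placed (place {a = a ∘ suc} (label ∘ suc) (suc-injective ∘ inj))
    z = proj₁ (a zero)
    x = proj₂ (a zero)
    ℓ = label zero
    vacant : grid z x ≡ nothing
    vacant with marked? (grid z x)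
    ... | inj₁ eq = eq
    ... | inj₂ mk with i , eq ← only (z , x) mk = contradiction (inj (sym eq)) 0≢1+n
    only′ : ∀ z′ x′ → Marked (mark grid z x ℓ z′ x′) → ∃[ i ] a i ≡ (z′ , x′)
    only′ z′ x′ (ℓ′ , eq) with z′ ≟ z | x′ ≟ x
    ... | yes refl | yes refl = zero , refl
    ... | no z′≢z  | _
      with i , eq′ ← only (z′ , x′) (ℓ′ , trans (sym (cong (λ R → R x′) (mark-otherʳ {μ = grid} z′≢z))) eq) =
      suc i , eq′
    ... | yes _ | no x′≢x
      with i , eq′ ← only (z′ , x′) (ℓ′ , trans (sym (mark-otherᶜ {μ = grid} z′ x′≢x)) eq) =
      suc i , eq′

-- Simple routes

data Route {a ℓ} {A : Set a} (R : Rel A ℓ) : A → List A → A → Set (a ⊔ ℓ) where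
  stop : ∀ {x} → Route R x List.[ x ] x
  step : ∀ {x y z xs} → R x y → Route R y xs z → Route R x (x List.∷ xs) z

module _ {a ℓ} {A : Set a} {R : Rel A ℓ} where

  route-head : ∀ {x xs y} → Route R x xs y → x ∈ₗ xs
  route-head stop       = here refl
  route-head (step _ _) = here refl

  route-from : ∀ {x xs y z} → Route R x xs y → Unique xs → z ∈ₗ xs → ∃[ zs ] Route R z zs y × Unique zs
  route-from stop         uniq        (here refl) = _ , stop , uniq
  route-from (step r ρ) uniq        (here refl) = _ , step r ρ , uniq
  route-from (step r ρ) (_ ∷ᵘ uniq) (there z∈)  = route-from ρ uniq z∈

  -- Loop erasure: if the first vertex occurs again on the simple route already found, the final
  -- segment starting there is taken instead.
  simple-route : DecidableEquality A → ∀ {x y} → Star R x y → ∃[ xs ] Route R x xs y × Unique xs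
  simple-route _≟ᴬ_ ε = _ , stop , All.[] ∷ᵘ []ᵘ
  simple-route _≟ᴬ_ (_◅_ {x} r w) with simple-route _≟ᴬ_ w
  ... | xs , ρ , uniq with Any.any? (x ≟ᴬ_) xs
  ...   | yes x∈xs = route-from ρ uniq x∈xs
  ...   | no x∉xs  = x List.∷ xs , step r ρ , All.¬Any⇒All¬ xs x∉xs ∷ᵘ uniq

  route-all : ∀ {p} {Q : A → Set p} → (∀ {x y} → R x y → Q x × Q y) →
    ∀ {x xs y} → Q x → Route R x xs y → All.All Q xs
  route-all RQ qx stop       = qx All.∷ All.[]
  route-all RQ qx (step r ρ) = qx All.∷ route-all RQ (proj₂ (RQ r)) ρ

-- Linkages in the grid

sum-δ≤1 : ∀ {k} (let open Knitting (Fin k) _≟_) ℓ → sum (δ ℓ) ≤ 1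
sum-δ≤1 {k} ℓ = ℕ.≤-reflexive (begin
  sum (δ ℓ)                  ≡⟨ ℕ.+-identityʳ _ ⟨
  sum (δ ℓ) + 0              ≡⟨ sum-replace {g = λ _ → 0} ℓ off ⟩
  sum {k} (λ _ → 0) + δ ℓ ℓ  ≡⟨ cong₂ _+_ (trans (sum-const {k} 0 (λ _ → refl)) (ℕ.*-zeroʳ k)) (δ-same ℓ) ⟩
  1                          ∎)
  where
  open Knitting (Fin k) _≟_
  open ≡-Reasoning
  off : ∀ j → j ≢ ℓ → δ ℓ j ≡ 0
  off j j≢ℓ with ℓ ≟ j
  ... | yes ℓ≡j = contradiction (sym ℓ≡j) j≢ℓ
  ... | no _    = refl

2*⌊n/2⌋≤n : ∀ n → 2 * ⌊ n /2⌋ ≤ n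
2*⌊n/2⌋≤n n = begin
  ⌊ n /2⌋ + (⌊ n /2⌋ + 0)  ≡⟨ cong (⌊ n /2⌋ +_) (ℕ.+-identityʳ _) ⟩
  ⌊ n /2⌋ + ⌊ n /2⌋        ≤⟨ ℕ.+-monoʳ-≤ ⌊ n /2⌋ (ℕ.⌊n/2⌋≤⌈n/2⌉ n) ⟩
  ⌊ n /2⌋ + ⌈ n /2⌉        ≡⟨ ℕ.⌊n/2⌋+⌈n/2⌉≡n n ⟩
  n                        ∎
  where open ℕ.≤-Reasoning

module Linkage {m n k} (s t : Fin k → Fin (suc m) × Fin (suc n))
  (st-inj : Injective _≡_ _≡_ [ s , t ]′) (2k≤m+n : 2 * k ≤ m + n) where

  open Knitting (Fin k) _≟_ public
  open Placement (Fin k) _≟_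
  open SumSplit ℕ.+-0-commutativeMonoid using (sum-split)

  terminal : Fin (k + k) → Cell (suc m) (suc n)
  terminal = [ s , t ]′ ∘ splitAt k

  pair : Fin (k + k) → Fin k
  pair = [ id , id ]′ ∘ splitAt k

  terminal-injective : Injective _≡_ _≡_ terminal
  terminal-injective {i} {j} eq = begin
    i                        ≡⟨ join-splitAt k k i ⟨
    join k k (splitAt k i)   ≡⟨ cong (join k k) (st-inj {splitAt k i} {splitAt k j} eq) ⟩
    join k k (splitAt k j)   ≡⟨ join-splitAt k k j ⟩
    j                        ∎
    where open ≡-Reasoning

  open Placed (place {a = terminal} pair terminal-injective)

  sum-pair : ∀ g → sum (g ∘ pair) ≡ sum g + sum g
  sum-pair g = trans (sum-split k (g ∘ pair)) (cong₂ _+_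
    (sum-cong-≗ λ i → cong (g ∘ [ id , id ]′) (splitAt-↑ˡ k i k))
    (sum-cong-≗ λ i → cong (g ∘ [ id , id ]′) (splitAt-↑ʳ k k i)))

  sparse : Sparse grid
  sparse = begin
    2 + count one grid    ≡⟨ cong (2 +_) (trans (total one) (sum-pair one)) ⟩
    2 + (sum {k} one + sum {k} one) ≡⟨ cong (λ K → 2 + (K + K)) (trans (sum-const {k} 1 (λ _ → refl)) (ℕ.*-identityʳ k)) ⟩
    2 + (k + k)           ≡⟨ cong (λ K → 2 + (k + K)) (ℕ.+-identityʳ k) ⟨
    2 + 2 * k             ≤⟨ s≤s (s≤s 2k≤m+n) ⟩
    2 + (m + n)           ≡⟨ cong suc (ℕ.+-suc m n) ⟨
    suc m + suc n         ∎
    where open ℕ.≤-Reasoning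

  paired : Paired grid
  paired ℓ = ℕ.≤-trans (ℕ.≤-reflexive (trans (total (δ ℓ)) (sum-pair (δ ℓ)))) (ℕ.+-mono-≤ (sum-δ≤1 ℓ) (sum-δ≤1 ℓ))

  open Knit (knits (suc m) (suc n) grid sparse paired) public using (χ)
  open Knit (knits (suc m) (suc n) grid sparse paired) using (extends; joined)

  at-s : ∀ i → at grid (s i) ≡ just i
  at-s i = subst (λ w → at grid ([ s , t ]′ w) ≡ just ([ id , id ]′ w)) (splitAt-↑ˡ k i k) (placed (i ↑ˡ k))

  at-t : ∀ i → at grid (t i) ≡ just i
  at-t i = subst (λ w → at grid ([ s , t ]′ w) ≡ just ([ id , id ]′ w)) (splitAt-↑ʳ k k i) (placed (k ↑ʳ i))

  Connected : Fin k → Set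
  Connected i = ∃[ us ] Route Line (s i) us (t i) × Unique us × All.All (λ u → at χ u ≡ just i) us

  connected : ∀ i → Connected i
  connected i with us , ρ , uniq ← simple-route (≡-dec _≟_ _≟_) (joined {u = s i} {v = t i} (at-s i) (at-t i)) =
    us , route-map ρ , uniq , route-all proj₂ (extends _ _ i (at-s i)) ρ
    where
    route-map : ∀ {x us y} → Route (Link χ i) x us y → Route Line x us y
    route-map stop       = stop
    route-map (step r ρ) = step (proj₁ r) (route-map ρ)

-- Transfer to a graph whose vertices lie over cells

private
  _≟ᶜ_ : ∀ {m n} → DecidableEquality (Fin m × Fin n)
  _≟ᶜ_ = ≡-dec _≟_ _≟_

-- `Over` matches cells with classes of equal vertices rather than with single vertices, since a
-- vertex of a polytope graph includes the proof that it is one.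
module RookGraph {v e ℓ p} (G : Graph v e ℓ) {m n : ℕ}
  (Over       : Graph.Vertex G → Fin (suc m) × Fin (suc n) → Set p)
  (cellOf     : ∀ x → ∃ (Over x))
  (vertexOver : ∀ u → ∃ λ x → Over x u)
  (equal      : ∀ {x y u} → Over x u → Over y u → Graph._≈_ G x y)
  (distinct   : ∀ {x y u v} → Over x u → Over y v → Graph._≈_ G x y → u ≡ v)
  (adjacent   : ∀ x y u v → Over x u → Over y v → proj₁ u ≡ proj₁ v ⊎ proj₂ u ≡ proj₂ v → u ≢ v →
                Graph._~_ G x y)
  where

  open Graph G
  open DisjointSetoid vertices using (Disjoint)
  open Membership vertices using () renaming (_∈_ to _∈ᵥ_)
  private module ≈ = Setoid vertices

  Cell : Set
  Cell = Fin (suc m) × Fin (suc n)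

  cell : Vertex → Cell
  cell x = proj₁ (cellOf x)

  over : ∀ x → Over x (cell x)
  over x = proj₂ (cellOf x)

  injection : ∀ {k} → 2 * k ≤ m + n → Injection (setoid (Fin (2 * k))) vertices
  injection {k} 2k≤m+n = record
    { to        = λ i → proj₁ (vertexOver (pick i))
    ; cong      = λ { refl → ≈.refl }
    ; injective = λ {i} {j} eq → inject≤-injective bound bound i j
        (pick-injective (distinct (proj₂ (vertexOver (pick i))) (proj₂ (vertexOver (pick j))) eq))
    }
    where
    bound : 2 * k ≤ suc m * suc n
    bound = begin
      2 * k                       ≤⟨ 2k≤m+n ⟩
      m + n                     ≡⟨ ℕ.+-comm m n ⟩
      n + m                     ≤⟨ ℕ.+-mono-≤ (ℕ.n≤1+n n) (ℕ.m≤m*n m (suc n)) ⟩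
      suc n + m * suc n        ∎
      where open ℕ.≤-Reasoning
    pick : Fin (2 * k) → Cell
    pick i = remQuot (suc n) (inject≤ i bound)
    pick-injective : ∀ {i j} → pick i ≡ pick j → inject≤ i bound ≡ inject≤ j bound
    pick-injective {i} {j} eq = begin
      inject≤ i bound                                  ≡⟨ combine-remQuot {suc m} (suc n) (inject≤ i bound) ⟨
      combine (proj₁ (pick i)) (proj₂ (pick i))        ≡⟨ cong (λ (a , b) → combine a b) eq ⟩
      combine (proj₁ (pick j)) (proj₂ (pick j))        ≡⟨ combine-remQuot {suc m} (suc n) (inject≤ j bound) ⟩
      inject≤ j bound                                  ∎
      where open ≡-Reasoning

  module _ {k} (2k≤m+n : 2 * k ≤ m + n) (s t : Fin k → Vertex)
    (st-inj : Injective _≡_ _≈_ [ s , t ]′) where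

    private
      terminal : Fin k ⊎ Fin k → Vertex
      terminal = [ s , t ]′

      cell-injective : ∀ i j → cell (terminal i) ≡ cell (terminal j) → i ≡ j
      cell-injective i j eq = st-inj {i} {j}
        (equal (over (terminal i)) (subst (Over (terminal j)) (sym eq) (over (terminal j))))

      cells-injective : Injective _≡_ _≡_ [ cell ∘ s , cell ∘ t ]′
      cells-injective {inj₁ i} {inj₁ j} eq = cell-injective (inj₁ i) (inj₁ j) eq
      cells-injective {inj₁ i} {inj₂ j} eq = cell-injective (inj₁ i) (inj₂ j) eq
      cells-injective {inj₂ i} {inj₁ j} eq = cell-injective (inj₂ i) (inj₁ j) eq
      cells-injective {inj₂ i} {inj₂ j} eq = cell-injective (inj₂ i) (inj₂ j) eq

      module Λ = Linkage (cell ∘ s) (cell ∘ t) cells-injective 2k≤m+n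

      -- A vertex carries a proof besides its point, so the terminals themselves have to be
      -- used as the vertices of their cells for the paths to end at them.
      lift : Cell → Vertex
      lift u with any? (λ i → cell (s i) ≟ᶜ u) | any? (λ i → cell (t i) ≟ᶜ u)
      ... | yes (i , _) | _           = s i
      ... | no _        | yes (i , _) = t i
      ... | no _        | no _        = proj₁ (vertexOver u)

      lift-over : ∀ u → Over (lift u) u
      lift-over u with any? (λ i → cell (s i) ≟ᶜ u) | any? (λ i → cell (t i) ≟ᶜ u)
      ... | yes (i , refl) | _              = over (s i)
      ... | no _           | yes (i , refl) = over (t i)
      ... | no _           | no _           = proj₂ (vertexOver u)

      lift-s : ∀ i → lift (cell (s i)) ≡ s i
      lift-s i with any? (λ j → cell (s j) ≟ᶜ cell (s i)) | any? (λ j → cell (t j) ≟ᶜ cell (s i))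
      ... | no none      | _ = contradiction (i , refl) none
      ... | yes (j , eq) | _ with refl ← cell-injective (inj₁ j) (inj₁ i) eq = refl

      lift-t : ∀ i → lift (cell (t i)) ≡ t i
      lift-t i with any? (λ j → cell (s j) ≟ᶜ cell (t i)) | any? (λ j → cell (t j) ≟ᶜ cell (t i))
      ... | yes (j , eq) | _            = contradiction (cell-injective (inj₁ j) (inj₂ i) eq) λ ()
      ... | no _         | no none      = contradiction (i , refl) none
      ... | no _         | yes (j , eq) with refl ← cell-injective (inj₂ j) (inj₂ i) eq = refl

      lift-injective : ∀ {u v} → lift u ≈ lift v → u ≡ v
      lift-injective {u} {v} = distinct (lift-over u) (lift-over v)

      walk : ∀ {u us v} → Route Λ.Line u us v → Unique us →
        Σ (Star _~_ (lift u) (lift v)) λ w → support G w ≡ List.map lift us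
      walk stop _ = ε , refl
      -- `Line` also relates a cell to itself. Uniqueness along the route excludes this, as
      -- adjacency demands distinct cells.
      walk (step {u} {v} line ρ) (u∉us ∷ᵘ uniq) with w , eq ← walk ρ uniq =
        adjacent (lift u) (lift v) u v (lift-over u) (lift-over v) line
          (All.lookup u∉us (route-head ρ)) ◅ w , cong (lift u List.∷_) eq

      relocate : ∀ {x x′ y y′} → x ≡ x′ → y ≡ y′ → (w : Star _~_ x y) →
        Σ (Star _~_ x′ y′) λ w′ → support G w′ ≡ support G w
      relocate refl refl w = w , refl

      walk-between : ∀ i (C : Λ.Connected i) → Σ (Star _~_ (s i) (t i)) λ w → support G w ≡ List.map lift (proj₁ C)
      walk-between i (us , ρ , uniq , _) =
        let w , eq = walk ρ uniq ; w′ , eq′ = relocate (lift-s i) (lift-t i) w in w′ , trans eq′ eq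

      walks : ∀ i → Σ (Star _~_ (s i) (t i)) λ w → support G w ≡ List.map lift (proj₁ (Λ.connected i))
      walks i = walk-between i (Λ.connected i)

      paths : ∀ i → Path G (s i) (t i)
      paths i = proj₁ (walks i) , subst Unique′ (sym (proj₂ (walks i)))
        (UniqueProperties.map⁺ (setoid Cell) vertices lift-injective (proj₁ (proj₂ (proj₂ (Λ.connected i)))))
        where open UniqueSetoid vertices using () renaming (Unique to Unique′)

      coloured : ∀ i {x} → x ∈ᵥ support G (proj₁ (paths i)) → ∃[ u ] x ≈ lift u × Λ.at Λ.χ u ≡ just i
      coloured i {x} x∈ with u , u∈ , x≈ ← find (Any.map⁻ (subst (x ∈ᵥ_) (proj₂ (walks i)) x∈)) =
        u , x≈ , All.lookup (proj₂ (proj₂ (proj₂ (Λ.connected i)))) u∈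

    linkage : Σ ((i : Fin k) → Path G (s i) (t i)) λ L →
      ∀ {i j} → i ≢ j → Disjoint (support G (proj₁ (L i))) (support G (proj₁ (L j)))
    -- A common vertex lies over a single cell, whose colour would be the index of both paths.
    linkage = paths , λ {i} {j} i≢j (x∈i , x∈j) → i≢j (same (coloured i x∈i) (coloured j x∈j))
      where
      same : ∀ {i j x} → ∃[ u ] x ≈ lift u × Λ.at Λ.χ u ≡ just i → ∃[ u ] x ≈ lift u × Λ.at Λ.χ u ≡ just j → i ≡ j
      same (u , x≈u , χu) (u′ , x≈u′ , χu′) with refl ← lift-injective (≈.trans (≈.sym x≈u) x≈u′) =
        just-injective (trans (sym χu) χu′)

  linked : ∀ {k} → 2 * k ≤ m + n → Linked G k
  linked {k} 2k≤m+n = injection {k} 2k≤m+n , linkage 2k≤m+n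

corollary4 : ∀ {c ℓ₁ ℓ₂ ℓ₃} (𝔽 : OrderedField c ℓ₁ ℓ₂ ℓ₃) →
    let open Polytopes 𝔽 in
    (d₁ d₂ : ℕ) (T₁ : Simplex d₁) (T₂ : Simplex d₂) →
    Linked (graph (Simplex.hull T₁ ×ˢ Simplex.hull T₂)) ⌊ d₁ + d₂ /2⌋
corollary4 𝔽 d₁ d₂ T₁ T₂ = linked {⌊ d₁ + d₂ /2⌋} (2*⌊n/2⌋≤n (d₁ + d₂))
  where
  open Polytopes 𝔽
  open Geometry 𝔽 using (module Product; module ≋)
  open Product {p = Simplex.points T₁} (Simplex.affinelyIndependent T₁)
    {q = Simplex.points T₂} (Simplex.affinelyIndependent T₂)
  open RookGraph (graph P) (λ x u → proj₁ x ≋ r u)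
    (λ (_ , isV) → vertex≋r isV)
    (λ u → (r u , isVertex u) , ≋.refl)
    (λ x≋ y≋ → ≋.trans x≋ (≋.sym y≋))
    (λ x≋ y≋ x≋y → r-injective (≋.trans (≋.sym x≋) (≋.trans x≋y y≋)))
    adjacent
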